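{- Let $n\geq 5$. If every graph in $\mathcal{GAQ}_{n-1}$ has fractional strong matching preclusion number $2n-3$ (i.e. every graph in $\mathcal{GAQ}_{n-1}$ is fractional strongly maximally matched), then every graph in $\mathcal{GAQ}_n$ has fractional strong matching preclusion number $2n-1$ (i.e. every graph in $\mathcal{GAQ}_n$ is fractional strongly maximally matched).
   Context: All graphs are finite, simple, undirected. For a graph $G$ and a set $F\subseteq V(G)\cup E(G)$, $G-F$ is obtained by deleting the vertices and edges of $F$. A function $f:E(G)\to[0,1]$ is a fractional perfect matching if $\sum_{e\ni v} f(e)=1$ for every vertex $v$. A set $F\subseteq V(G)\cup E(G)$ is a fractional strong matching preclusion (FSMP) set if $G-F$ has no fractional perfect matching; the fractional strong matching preclusion number $fsmp(G)$ is the minimum size of an FSMP set. $G$ is fractional strongly maximally matched if $fsmp(G)=\delta(G)$ (minimum degree). The augmented cube $AQ_n$: vertices are $n$-bit binary strings; $AQ_1\cong K_2$; for $n\geq2$, take copies $AQ^0_{n-1}$ and $AQ^1_{n-1}$ of $AQ_{n-1}$ (vertices prefixed by $0$ and $1$ respectively), and join $0u_1\cdots u_{n-1}$ to $1v_1\cdots v_{n-1}$ iff $u_i=v_i$ for all $i$ or $u_i\neq v_i$ for all $i$. $\mathcal{GAQ}_4=\{AQ_4\}$; for $n\geq5$, $\mathcal{GAQ}_n$ consists of all graphs $(V_1\cup V_2,E_1\cup E_2\cup M_1\cup M_2)$ with $(V_1,E_1),(V_2,E_2)\in\mathcal{GAQ}_{n-1}$ on disjoint vertex sets and $M_1,M_2$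 edge-disjoint perfect matchings between $V_1$ and $V_2$. Every graph in $\mathcal{GAQ}_n$ is $(2n-1)$-regular on $2^n$ vertices.
   Formalization: Fractional perfect matchings f are taken with rational values in [0,1] instead of real values; since the defining linear constraints are rational, a real fractional perfect matching exists exactly when a rational one does. -}

module Defs where

open import Data.Nat using (ℕ; zero; suc; _+_; _<ᵇ_)
open import Data.Bool using (Bool; true; false; _∧_; _∨_; not; if_then_else_)
open import Data.Fin using (Fin; splitAt; _↑ˡ_; _↑ʳ_; toℕ; _≟_)
open import Data.Sum using (_⊎_; inj₁; inj₂; [_,_]′)
open import Data.Product using (Σ; _×_; _,_)
open import Data.Rational using (ℚ; 0ℚ; 1ℚ) renaming (_+_ to _+ℚ_; _≤_ to _≤ℚ_)
open import Relation.Binary.PropositionalEquality using (_≡_; _≢_; refl)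
open import Relation.Nullary using (¬_)
open import Relation.Nullary.Decidable using (⌊_⌋)
open import Function.Bundles using (_↔_; Inverse)
import Data.Nat as ℕ

record Graph : Set where
  field
    N       : ℕ
    adj     : Fin N → Fin N → Bool
    adj-sym : ∀ u v → adj u v ≡ adj v u
    adj-irr : ∀ v → adj v v ≡ false
open Graph public

sumℕ : ∀ {n} → (Fin n → ℕ) → ℕ
sumℕ {zero}  f = 0
sumℕ {suc n} f = f Fin.zero + sumℕ (λ i → f (Fin.suc i))
  where import Data.Fin as Fin

sumℚ : ∀ {n} → (Fin n → ℚ) → ℚ
sumℚ {zero}  f = 0ℚ
sumℚ {suc n} f = f Fin.zero +ℚ sumℚ (λ i → f (Fin.suc i))
  where import Data.Fin as Fin

count : ∀ {n} → (Fin n → Bool) → ℕ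
count f = sumℕ (λ i → if f i then 1 else 0)

record Deletion (G : Graph) : Set where
  field
    delV     : Fin (N G) → Bool
    delE     : Fin (N G) → Fin (N G) → Bool
    delE-sym : ∀ u v → delE u v ≡ delE v u
    delE-adj : ∀ u v → delE u v ≡ true → adj G u v ≡ true
open Deletion public

-- |F| = number of deleted vertices + number of deleted edges
-- (each edge {u,v} counted once, via the pair with toℕ u < toℕ v).
size : ∀ {G} → Deletion G → ℕ
size {G} F = count (delV F)
           + sumℕ (λ u → count (λ v → (toℕ u <ᵇ toℕ v) ∧ delE F u v))

alive : ∀ {G} → Deletion G → Fin (N G) → Bool
alive F v = not (delV F v)

edgeIn : ∀ {G} → Deletion G → Fin (N G) → Fin (N G) → Bool
edgeIn {G} F u v = alive F u ∧ alive F v ∧ adj G u v ∧ not (delE F u v)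

-- Fractional perfect matching of G - F: f : E(G - F) → [0,1] (encoded as a
-- symmetric function on vertex pairs vanishing off E(G - F)) with
-- Σ_{e ∋ v} f(e) = 1 for every vertex v of G - F.

record FracPerfectMatching (G : Graph) (F : Deletion G) : Set where
  field
    f        : Fin (N G) → Fin (N G) → ℚ
    f-sym    : ∀ u v → f u v ≡ f v u
    f-supp   : ∀ u v → edgeIn F u v ≡ false → f u v ≡ 0ℚ
    f-nonneg : ∀ u v → 0ℚ ≤ℚ f u v
    f-le1    : ∀ u v → f u v ≤ℚ 1ℚ
    f-sum    : ∀ v → alive F v ≡ true → sumℚ (λ u → f v u) ≡ 1ℚ

IsFSMPSet : (G : Graph) → Deletion G → Set
IsFSMPSet G F = ¬ FracPerfectMatching G F

FsmpEq : Graph → ℕ → Set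
FsmpEq G k = Σ (Deletion G) (λ F → IsFSMPSet G F × size F ≡ k)
           × (∀ (F : Deletion G) → IsFSMPSet G F → k ℕ.≤ size F)

module _ {a b : ℕ} (adj₁ : Fin a → Fin a → Bool) (adj₂ : Fin b → Fin b → Bool)
         (σ₁ σ₂ : Fin a → Fin b) where

  crossAdj : Fin a → Fin b → Bool
  crossAdj x y = ⌊ σ₁ x ≟ y ⌋ ∨ ⌊ σ₂ x ≟ y ⌋

  sumAdj : Fin a ⊎ Fin b → Fin a ⊎ Fin b → Bool
  sumAdj (inj₁ x) (inj₁ y) = adj₁ x y
  sumAdj (inj₂ x) (inj₂ y) = adj₂ x y
  sumAdj (inj₁ x) (inj₂ y) = crossAdj x y
  sumAdj (inj₂ x) (inj₁ y) = crossAdj y x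

combine : (G₁ G₂ : Graph) → (σ₁ σ₂ : Fin (N G₁) → Fin (N G₂)) → Graph
combine G₁ G₂ σ₁ σ₂ = record
  { N       = N G₁ + N G₂
  ; adj     = λ u v → sumAdj (adj G₁) (adj G₂) σ₁ σ₂ (splitAt (N G₁) u) (splitAt (N G₁) v)
  ; adj-sym = λ u v → sym' (splitAt (N G₁) u) (splitAt (N G₁) v)
  ; adj-irr = λ v → irr' (splitAt (N G₁) v)
  }
  where
  sym' : ∀ x y → sumAdj (adj G₁) (adj G₂) σ₁ σ₂ x y ≡ sumAdj (adj G₁) (adj G₂) σ₁ σ₂ y x
  sym' (inj₁ x) (inj₁ y) = adj-sym G₁ x y
  sym' (inj₂ x) (inj₂ y) = adj-sym G₂ x y
  sym' (inj₁ x) (inj₂ y) = refl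
  sym' (inj₂ x) (inj₁ y) = refl
  irr' : ∀ x → sumAdj (adj G₁) (adj G₂) σ₁ σ₂ x x ≡ false
  irr' (inj₁ x) = adj-irr G₁ x
  irr' (inj₂ x) = adj-irr G₂ x

-- Augmented cubes.  AQ n has vertex set Fin (sz n); vertex with index i
-- stands for the n-bit string: first half of indices = leading bit 0,
-- second half = leading bit 1 (recursively).  comp n is bitwise complement.
-- AQ 0 = K₁, and AQ (suc n) joins 0u to 1v iff u = v or u = complement v
-- (so AQ 1 ≅ K₂, as in the paper).

sz : ℕ → ℕ
sz zero    = 1
sz (suc n) = sz n + sz n

comp : ∀ n → Fin (sz n) → Fin (sz n)
comp zero    x = x
comp (suc n) x = [ (λ y → sz n ↑ʳ comp n y) , (λ y → comp n y ↑ˡ sz n) ]′ (splitAt (sz n) x)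

K₁ : Graph
K₁ = record { N = 1 ; adj = λ _ _ → false ; adj-sym = λ _ _ → refl ; adj-irr = λ _ → refl }

AQ : ℕ → Graph
AQsz : ∀ n → N (AQ n) ≡ sz n
AQ zero    = K₁
AQ (suc n) = combine (AQ n) (AQ n) (λ x → x) (λ x → fromSz (comp n (toSz x)))
  where
  toSz : Fin (N (AQ n)) → Fin (sz n)
  toSz x rewrite AQsz n = x
  fromSz : Fin (sz n) → Fin (N (AQ n))
  fromSz x rewrite AQsz n = x
AQsz zero    = refl
AQsz (suc n) rewrite AQsz n = refl

-- The family 𝒢𝒜𝒬 n (n ≥ 4), up to the choice of vertex labelling:
-- 𝒢𝒜𝒬 4 = {AQ 4}; a graph of 𝒢𝒜𝒬 (n+1) is obtained from two graphs of
-- 𝒢𝒜𝒬 n and two edge-disjoint perfect matchings M₁, M₂ between their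
-- vertex sets (a perfect matching between V₁ and V₂ = a bijection V₁ ↔ V₂).

data GAQ : ℕ → Graph → Set where
  base : GAQ 4 (AQ 4)
  step : ∀ {n G₁ G₂} → GAQ n G₁ → GAQ n G₂
       → (M₁ M₂ : Fin (N G₁) ↔ Fin (N G₂))
       → (∀ v → Inverse.to M₁ v ≢ Inverse.to M₂ v)
       → GAQ (suc n) (combine G₁ G₂ (Inverse.to M₁) (Inverse.to M₂))

{-# OPTIONS --safe #-}
-- Let k = fsmp(G₁) = fsmp(G₂) and |F| ≤ k + 1. If both halves lose fewer than k elements, fractional perfect
-- matchings of the halves give one of G - F. Otherwise one half, say G₁, loses at least k elements and at most
-- one fault lies outside it. Restoring one or two faults of G₁ yields a fractional perfect matching; deleting
-- them again leaves a deficit of total at most 2 per restored fault, which is sent across a perfect matching to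
-- G₂. The remaining demand 1 - d on G₂ (0 ≤ d ≤ 1, Σ d ≤ r) is a convex combination of the demands 1 - 1_S with
-- |S| ≤ r, and each of those is met because G₂ tolerates the deletion of S. Only a single fault blocking a
-- matching edge needs care: one vertex is then rerouted along the other matching, and the restored fault is
-- chosen so that its deficit does not collide with another one there.
-- As fsmp is characterised by non-existence, matchings are only needed up to double negation.
module Submission where

open import Defs
open import Algebra.Core using (Op₂)
open import Algebra.Structures using (IsCommutativeMonoid)
open import Data.Bool using (Bool; true; false; _∧_; _∨_; not; if_then_else_; T)
import Data.Bool.Properties as Bool
open import Data.Empty using (⊥-elim)
open import Data.Fin using (Fin; zero; suc; toℕ; splitAt; join; _↑ˡ_; _↑ʳ_; _≟_)
import Data.Fin.Properties as Fin
open import Data.Nat using (ℕ; zero; suc; _+_; _*_; _∸_; _≤_; _<_; _<ᵇ_; z≤n; s≤s)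
import Data.Nat.Properties as ℕ
open import Data.Nat.Tactic.RingSolver using (solve-∀)
open import Data.Product using (Σ; ∃; _×_; _,_; proj₁)
open import Data.Rational as ℚ using (ℚ; 0ℚ; 1ℚ)
import Data.Rational.Properties as ℚ
open import Data.Rational.Solver using (module +-*-Solver)
open import Data.Sum as Sum using (_⊎_; inj₁; inj₂; [_,_]′)
open import Data.Unit using (⊤)
open import Data.Vec.Functional using (_∷_)
open import Function using (_∘_)
open import Function.Bundles using (_↔_; Inverse)
open import Function.Properties.Inverse using (↔-sym)
open import Level using (0ℓ)
open import Relation.Binary.Core using (Rel)
open import Relation.Binary.Definitions using (tri<; tri≈; tri>)
open import Relation.Binary.PropositionalEquality
open import Relation.Nullary using (¬_; yes; no)
open import Relation.Nullary.Decidable using (⌊_⌋; toWitness)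
open +-*-Solver using (solve; _:=_; _:+_; _:*_; _:-_; con)
open Inverse using (to; from; strictlyInverseˡ; strictlyInverseʳ)

-- Finite sums in an ordered commutative monoid

module FiniteSum
  {A : Set} {_⊕_ : Op₂ A} {ε : A} (isCM : IsCommutativeMonoid _≡_ _⊕_ ε)
  (_≼_ : Rel A 0ℓ) (≼-refl : ∀ {x} → x ≼ x)
  (⊕-mono : ∀ {x y u v} → x ≼ y → u ≼ v → (x ⊕ u) ≼ (y ⊕ v))
  -- The sum is a parameter characterised by its recursion equations, so that the lemmas apply
  -- verbatim to both `sumℕ` and `sumℚ`.
  (S : ∀ {n} → (Fin n → A) → A)
  (S-zero : (f : Fin 0 → A) → S f ≡ ε)
  (S-suc : ∀ {n} (f : Fin (suc n) → A) → S f ≡ f zero ⊕ S (f ∘ suc))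
  where

  open IsCommutativeMonoid isCM using (assoc; comm; identityˡ; identityʳ)

  private
    interchange : ∀ a b c d → (a ⊕ b) ⊕ (c ⊕ d) ≡ (a ⊕ c) ⊕ (b ⊕ d)
    interchange a b c d = begin
      (a ⊕ b) ⊕ (c ⊕ d)  ≡⟨ assoc a b _ ⟩
      a ⊕ (b ⊕ (c ⊕ d))  ≡⟨ cong (a ⊕_) (assoc b c d) ⟨
      a ⊕ ((b ⊕ c) ⊕ d)  ≡⟨ cong (λ z → a ⊕ (z ⊕ d)) (comm b c) ⟩
      a ⊕ ((c ⊕ b) ⊕ d)  ≡⟨ cong (a ⊕_) (assoc c b d) ⟩
      a ⊕ (c ⊕ (b ⊕ d))  ≡⟨ assoc a c _ ⟨
      (a ⊕ c) ⊕ (b ⊕ d)  ∎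
      where open ≡-Reasoning

  sum-cong : ∀ {n} {f g : Fin n → A} → (∀ i → f i ≡ g i) → S f ≡ S g
  sum-cong {zero}  {f} {g} h = trans (S-zero f) (sym (S-zero g))
  sum-cong {suc n} {f} {g} h =
    trans (S-suc f) (trans (cong₂ _⊕_ (h zero) (sum-cong (h ∘ suc))) (sym (S-suc g)))

  sum-const-ε : ∀ {n} → S {n} (λ _ → ε) ≡ ε
  sum-const-ε {zero}  = S-zero _
  sum-const-ε {suc n} = trans (S-suc _) (trans (identityˡ _) (sum-const-ε {n}))

  sum-ε : ∀ {n} {f : Fin n → A} → (∀ i → f i ≡ ε) → S f ≡ ε
  sum-ε h = trans (sum-cong h) sum-const-ε

  sum-⊕ : ∀ {n} (f g : Fin n → A) → S (λ i → f i ⊕ g i) ≡ S f ⊕ S g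
  sum-⊕ {zero}  f g = trans (S-zero _) (sym (trans (cong₂ _⊕_ (S-zero f) (S-zero g)) (identityˡ ε)))
  sum-⊕ {suc n} f g = begin
    S (λ i → f i ⊕ g i)                                          ≡⟨ S-suc _ ⟩
    (f zero ⊕ g zero) ⊕ S (λ i → f (suc i) ⊕ g (suc i))          ≡⟨ cong (_ ⊕_) (sum-⊕ (f ∘ suc) (g ∘ suc)) ⟩
    (f zero ⊕ g zero) ⊕ (S (f ∘ suc) ⊕ S (g ∘ suc))              ≡⟨ interchange _ _ _ _ ⟩
    (f zero ⊕ S (f ∘ suc)) ⊕ (g zero ⊕ S (g ∘ suc))              ≡⟨ cong₂ _⊕_ (S-suc f) (S-suc g) ⟨
    S f ⊕ S g                                                    ∎
    where open ≡-Reasoning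

  sum-swap : ∀ {m n} (f : Fin m → Fin n → A) → S (λ i → S (f i)) ≡ S (λ j → S (λ i → f i j))
  sum-swap {zero}  f = trans (S-zero _) (sym (sum-ε (λ j → S-zero _)))
  sum-swap {suc m} f = begin
    S (λ i → S (f i))                                ≡⟨ S-suc _ ⟩
    S (f zero) ⊕ S (λ i → S (f (suc i)))             ≡⟨ cong (S (f zero) ⊕_) (sum-swap (f ∘ suc)) ⟩
    S (f zero) ⊕ S (λ j → S (λ i → f (suc i) j))     ≡⟨ sum-⊕ _ _ ⟨
    S (λ j → f zero j ⊕ S (λ i → f (suc i) j))       ≡⟨ sum-cong (λ j → S-suc _) ⟨
    S (λ j → S (λ i → f i j))                        ∎
    where open ≡-Reasoning

  sum-splitAt : ∀ m {n} (f : Fin (m + n) → A) → S f ≡ S (λ i → f (i ↑ˡ n)) ⊕ S (λ j → f (m ↑ʳ j))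
  sum-splitAt zero    f = sym (trans (cong (_⊕ S f) (S-zero _)) (identityˡ _))
  sum-splitAt (suc m) f = begin
    S f                                             ≡⟨ S-suc f ⟩
    f zero ⊕ S (f ∘ suc)                            ≡⟨ cong (f zero ⊕_) (sum-splitAt m (f ∘ suc)) ⟩
    f zero ⊕ (S (λ i → f (suc (i ↑ˡ _))) ⊕ _)       ≡⟨ assoc _ _ _ ⟨
    (f zero ⊕ S (λ i → f (suc (i ↑ˡ _)))) ⊕ _       ≡⟨ cong (_⊕ _) (S-suc _) ⟨
    S (λ i → f (i ↑ˡ _)) ⊕ _                        ∎
    where open ≡-Reasoning

  -- Each side is the common part of `f` and `g` plus both values at `i`. The subtraction-free form
  -- serves ℕ as well as ℚ.
  sum-update : ∀ {n} (f g : Fin n → A) i → (∀ j → j ≢ i → f j ≡ g j) → S f ⊕ g i ≡ S g ⊕ f i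
  sum-update f g zero h = begin
    S f ⊕ g zero                       ≡⟨ cong (_⊕ g zero) (S-suc f) ⟩
    (f zero ⊕ S (f ∘ suc)) ⊕ g zero    ≡⟨ comm _ _ ⟩
    g zero ⊕ (f zero ⊕ S (f ∘ suc))    ≡⟨ cong (g zero ⊕_) (comm _ _) ⟩
    g zero ⊕ (S (f ∘ suc) ⊕ f zero)    ≡⟨ assoc _ _ _ ⟨
    (g zero ⊕ S (f ∘ suc)) ⊕ f zero    ≡⟨ cong (λ z → (g zero ⊕ z) ⊕ f zero) (sum-cong (λ j → h (suc j) (λ ()))) ⟩
    (g zero ⊕ S (g ∘ suc)) ⊕ f zero    ≡⟨ cong (_⊕ f zero) (S-suc g) ⟨
    S g ⊕ f zero                       ∎
    where open ≡-Reasoning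
  sum-update f g (suc i) h = begin
    S f ⊕ g (suc i)                          ≡⟨ cong (_⊕ g (suc i)) (S-suc f) ⟩
    (f zero ⊕ S (f ∘ suc)) ⊕ g (suc i)       ≡⟨ assoc _ _ _ ⟩
    f zero ⊕ (S (f ∘ suc) ⊕ g (suc i))       ≡⟨ cong₂ _⊕_ (h zero (λ ()))
                                                  (sum-update (f ∘ suc) (g ∘ suc) i (λ j j≢i → h (suc j) (j≢i ∘ Fin.suc-injective))) ⟩
    g zero ⊕ (S (g ∘ suc) ⊕ f (suc i))       ≡⟨ assoc _ _ _ ⟨
    (g zero ⊕ S (g ∘ suc)) ⊕ f (suc i)       ≡⟨ cong (_⊕ f (suc i)) (S-suc g) ⟨
    S g ⊕ f (suc i)                          ∎
    where open ≡-Reasoning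

  sum-single : ∀ {n} {f : Fin n → A} i → (∀ j → j ≢ i → f j ≡ ε) → S f ≡ f i
  sum-single {n} {f} i h = begin
    S f                       ≡⟨ identityʳ _ ⟨
    S f ⊕ ε                   ≡⟨ sum-update f (λ _ → ε) i h ⟩
    S {n} (λ _ → ε) ⊕ f i     ≡⟨ cong (_⊕ f i) (sum-const-ε {n}) ⟩
    ε ⊕ f i                   ≡⟨ identityˡ _ ⟩
    f i                       ∎
    where open ≡-Reasoning

  sum-indicator : ∀ {n} (i : Fin n) a → S (λ j → if ⌊ i ≟ j ⌋ then a else ε) ≡ a
  sum-indicator i a = trans (sum-single i off) on
    where
    off : ∀ j → j ≢ i → (if ⌊ i ≟ j ⌋ then a else ε) ≡ ε
    off j j≢i with i ≟ j
    ... | yes i≡j = ⊥-elim (j≢i (sym i≡j))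
    ... | no  _   = refl
    on : (if ⌊ i ≟ i ⌋ then a else ε) ≡ a
    on with i ≟ i
    ... | yes _  = refl
    ... | no i≢i = ⊥-elim (i≢i refl)

  sum-mono : ∀ {n} {f g : Fin n → A} → (∀ i → f i ≼ g i) → S f ≼ S g
  sum-mono {zero}  {f} {g} h = subst₂ _≼_ (sym (S-zero f)) (sym (S-zero g)) ≼-refl
  sum-mono {suc n} {f} {g} h = subst₂ _≼_ (sym (S-suc f)) (sym (S-suc g)) (⊕-mono (h zero) (sum-mono (h ∘ suc)))

  sum-nonneg : ∀ {n} {f : Fin n → A} → (∀ i → ε ≼ f i) → ε ≼ S f
  sum-nonneg {n} h = subst (_≼ _) (sum-const-ε {n}) (sum-mono h)

  -- The function concentrated at `i` lies below `f`, and its sum is `f i`.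
  term≤sum : ∀ {n} {f : Fin n → A} → (∀ i → ε ≼ f i) → ∀ i → f i ≼ S f
  term≤sum {f = f} h i = subst (_≼ S f) (sum-indicator i (f i)) (sum-mono below)
    where
    below : ∀ j → (if ⌊ i ≟ j ⌋ then f i else ε) ≼ f j
    below j with i ≟ j
    ... | yes refl = ≼-refl
    ... | no _     = h j

  two-terms≤sum : ∀ {n} {f : Fin n → A} → (∀ i → ε ≼ f i) → ∀ i j → i ≢ j → (f i ⊕ f j) ≼ S f
  two-terms≤sum {f = f} h i j i≢j =
    subst (_≼ S f) (trans (sum-⊕ _ _) (cong₂ _⊕_ (sum-indicator i (f i)) (sum-indicator j (f j)))) (sum-mono below)
    where
    below : ∀ l → ((if ⌊ i ≟ l ⌋ then f i else ε) ⊕ (if ⌊ j ≟ l ⌋ then f j else ε)) ≼ f l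
    below l with i ≟ l | j ≟ l
    ... | yes refl | yes refl = ⊥-elim (i≢j refl)
    ... | yes refl | no _     = subst (_≼ f l) (sym (identityʳ _)) ≼-refl
    ... | no _     | yes refl = subst (_≼ f l) (sym (identityˡ _)) ≼-refl
    ... | no _     | no _     = subst (_≼ f l) (sym (identityˡ _)) (h l)

module Σℕ = FiniteSum ℕ.+-0-isCommutativeMonoid _≤_ ℕ.≤-refl ℕ.+-mono-≤ sumℕ (λ _ → refl) (λ _ → refl)
module Σℚ = FiniteSum ℚ.+-0-isCommutativeMonoid ℚ._≤_ ℚ.≤-refl ℚ.+-mono-≤ sumℚ (λ _ → refl) (λ _ → refl)

sumℚ-*ˡ : ∀ {n} a (f : Fin n → ℚ) → sumℚ (λ i → a ℚ.* f i) ≡ a ℚ.* sumℚ f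
sumℚ-*ˡ {zero}  a f = sym (ℚ.*-zeroʳ a)
sumℚ-*ˡ {suc n} a f = trans (cong (a ℚ.* f zero ℚ.+_) (sumℚ-*ˡ a (f ∘ suc))) (sym (ℚ.*-distribˡ-+ a _ _))

-- Rational inequalities

-- Turns an inequality into a ring identity for the solver, once a visibly nonnegative difference
-- `x` is supplied.
≤-from-difference : ∀ {p q} x → 0ℚ ℚ.≤ x → q ≡ p ℚ.+ x → p ℚ.≤ q
≤-from-difference {p} x 0≤x refl = subst (ℚ._≤ p ℚ.+ x) (ℚ.+-identityʳ p) (ℚ.+-monoʳ-≤ p 0≤x)

p≤q⇒0≤q-p : ∀ {p q} → p ℚ.≤ q → 0ℚ ℚ.≤ q ℚ.- p
p≤q⇒0≤q-p {p} {q} p≤q = subst (ℚ._≤ q ℚ.- p) (ℚ.+-inverseʳ p) (ℚ.+-monoˡ-≤ (ℚ.- p) p≤q)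

0≤1 : 0ℚ ℚ.≤ 1ℚ
0≤1 = ℚ.nonNegative⁻¹ 1ℚ

+-nonneg : ∀ {p q} → 0ℚ ℚ.≤ p → 0ℚ ℚ.≤ q → 0ℚ ℚ.≤ p ℚ.+ q
+-nonneg = ℚ.+-mono-≤ {0ℚ} {_} {0ℚ}

*-nonneg : ∀ {p q} → 0ℚ ℚ.≤ p → 0ℚ ℚ.≤ q → 0ℚ ℚ.≤ p ℚ.* q
*-nonneg {p} {q} 0≤p 0≤q =
  subst (ℚ._≤ p ℚ.* q) (ℚ.*-zeroʳ p) (ℚ.*-monoˡ-≤-nonNeg p {{ℚ.nonNegative 0≤p}} 0≤q)

p≤p+q : ∀ {p q} → 0ℚ ℚ.≤ q → p ℚ.≤ p ℚ.+ q
p≤p+q {q = q} 0≤q = ≤-from-difference q 0≤q refl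

mix : ℚ → ℚ → ℚ → ℚ
mix w p q = w ℚ.* p ℚ.+ (1ℚ ℚ.- w) ℚ.* q

-- The weight is `(a - lo) / (hi - lo)`.
interpolate : ∀ {lo hi a} → lo ℚ.≤ a → a ℚ.≤ hi → ∃ λ w → 0ℚ ℚ.≤ w × w ℚ.≤ 1ℚ × a ≡ mix w hi lo
interpolate {lo} {hi} {a} lo≤a a≤hi with hi ℚ.≤? lo
-- Degenerate interval: the three numbers coincide, and weight 0 serves.
... | yes hi≤lo = 0ℚ , ℚ.≤-refl , 0≤1 ,
  trans (ℚ.≤-antisym (ℚ.≤-trans a≤hi hi≤lo) lo≤a)
        (solve 2 (λ h l → l := con 0ℚ :* h :+ (con 1ℚ :- con 0ℚ) :* l) refl hi lo)
... | no hi≰lo = w , 0≤w , w≤1 , a≡mix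
  where
  D = hi ℚ.- lo
  instance
    D-pos : ℚ.Positive D
    D-pos = ℚ.positive (subst (ℚ._< D) (ℚ.+-inverseʳ lo) (ℚ.+-monoˡ-< (ℚ.- lo) (ℚ.≰⇒> hi≰lo)))
    D-nonZero : ℚ.NonZero D
    D-nonZero = ℚ.pos⇒nonZero D
  1/D = ℚ.1/ D
  0≤1/D : 0ℚ ℚ.≤ 1/D
  0≤1/D = ℚ.nonNegative⁻¹ 1/D {{ℚ.pos⇒nonNeg 1/D {{ℚ.1/pos⇒pos D}}}}
  w = (a ℚ.- lo) ℚ.* 1/D
  0≤w : 0ℚ ℚ.≤ w
  0≤w = *-nonneg (p≤q⇒0≤q-p lo≤a) 0≤1/D
  w≤1 : w ℚ.≤ 1ℚ
  w≤1 = ≤-from-difference ((hi ℚ.- a) ℚ.* 1/D) (*-nonneg (p≤q⇒0≤q-p a≤hi) 0≤1/D)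
    (trans (sym (ℚ.*-inverseʳ D))
      (solve 4 (λ h l a i → (h :- l) :* i := (a :- l) :* i :+ (h :- a) :* i) refl hi lo a 1/D))
  a≡mix : a ≡ mix w hi lo
  a≡mix = begin
    a                                  ≡⟨ solve 2 (λ a l → a := (a :- l) :* con 1ℚ :+ l) refl a lo ⟩
    (a ℚ.- lo) ℚ.* 1ℚ ℚ.+ lo           ≡⟨ cong (λ z → (a ℚ.- lo) ℚ.* z ℚ.+ lo) (ℚ.*-inverseʳ D) ⟨
    (a ℚ.- lo) ℚ.* (D ℚ.* 1/D) ℚ.+ lo
      ≡⟨ solve 4 (λ h l a i → (a :- l) :* ((h :- l) :* i) :+ l
                     := ((a :- l) :* i) :* h :+ (con 1ℚ :- (a :- l) :* i) :* l) refl hi lo a 1/D ⟩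
    mix w hi lo                        ∎
    where open ≡-Reasoning

⟦_⟧ : Bool → ℚ
⟦ b ⟧ = if b then 1ℚ else 0ℚ

⟦_⟧≤1 : ∀ b → ⟦ b ⟧ ℚ.≤ 1ℚ
⟦ true ⟧≤1  = ℚ.≤-refl
⟦ false ⟧≤1 = 0≤1

fromℕ : ℕ → ℚ
fromℕ zero    = 0ℚ
fromℕ (suc n) = 1ℚ ℚ.+ fromℕ n

0≤fromℕ : ∀ n → 0ℚ ℚ.≤ fromℕ n
0≤fromℕ zero    = ℚ.≤-refl
0≤fromℕ (suc n) = +-nonneg 0≤1 (0≤fromℕ n)

-- Rounding

-- The combination `z` is described pointwise, which avoids function extensionality; weight 1 then
-- yields invariance under pointwise equality, as in `Convex-resp`.
Convex : ∀ {n} → ((Fin n → ℚ) → Set) → Set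
Convex P = ∀ {x y z} w → 0ℚ ℚ.≤ w → w ℚ.≤ 1ℚ → P x → P y → (∀ i → z i ≡ mix w (x i) (y i)) → P z

Convex-resp : ∀ {n} {P : (Fin n → ℚ) → Set} → Convex P → ∀ {x y} → (∀ i → x i ≡ y i) → P x → P y
Convex-resp conv {x} {y} x≗y Px = conv 1ℚ 0≤1 ℚ.≤-refl Px Px
  (λ i → trans (sym (x≗y i)) (solve 1 (λ a → a := con 1ℚ :* a :+ (con 1ℚ :- con 1ℚ) :* a) refl (x i)))

mix-const : ∀ w a → a ≡ mix w a a
mix-const = solve 2 (λ w a → a := w :* a :+ (con 1ℚ :- w) :* a) refl

-- The 0/1 points with coordinate sum at most r span { d ∈ [0,1]ⁿ : Σ d ≤ r }.
Roundable : ℕ → Set₁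
Roundable n = (P : (Fin n → ℚ) → Set) → Convex P → ∀ r → (∀ S → count S ≤ r → P (⟦_⟧ ∘ S)) →
  ∀ d → (∀ i → 0ℚ ℚ.≤ d i) → (∀ i → d i ℚ.≤ 1ℚ) → sumℚ d ℚ.≤ fromℕ r → P d

-- The first two coordinates are moved along their common sum until one of them is 0 or 1.
roundable-step : ∀ {m} → Roundable (suc m) → Roundable (suc (suc m))
roundable-step {m} ih P conv r vert d 0≤d d≤1 Σ≤r = [ small , large r vert Σ≤r ]′ (ℚ.≤-total s 1ℚ)
  where
  s = d zero ℚ.+ d (suc zero)
  rest : Fin m → ℚ
  rest i = d (suc (suc i))

  insert₁ : {A : Set} → A → (Fin (suc m) → A) → Fin (suc (suc m)) → A
  insert₁ c e = e zero ∷ c ∷ (e ∘ suc)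

  conv₀ : ∀ c → Convex (λ e → P (c ∷ e))
  conv₀ c w 0≤w w≤1 Px Py eq = conv w 0≤w w≤1 Px Py
    (λ { zero → mix-const w c ; (suc i) → eq i })

  conv₁ : ∀ c → Convex (λ e → P (insert₁ c e))
  conv₁ c w 0≤w w≤1 Px Py eq = conv w 0≤w w≤1 Px Py
    (λ { zero → eq zero ; (suc zero) → mix-const w c ; (suc (suc i)) → eq (suc i) })

  -- The segment joins `(c , p , rest)` to `(p , c , rest)`, where `c` is 0 or 1 and the first two
  -- coordinates keep their sum `s`. At each end the coordinate `c` is frozen, and the induction
  -- hypothesis treats `p ∷ rest` with budget `r′`.
  shift : ∀ c p r′ → 0ℚ ℚ.≤ p → p ℚ.≤ 1ℚ → p ℚ.+ sumℚ rest ℚ.≤ fromℕ r′ → s ≡ ⟦ c ⟧ ℚ.+ p →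
          (∀ S → count S ≤ r′ → P (⟦_⟧ ∘ (c ∷ S))) →
          (∀ S → count S ≤ r′ → P (⟦_⟧ ∘ insert₁ c S)) →
          (∃ λ w → 0ℚ ℚ.≤ w × w ℚ.≤ 1ℚ × d zero ≡ mix w ⟦ c ⟧ p) → P d
  shift c p r′ 0≤p p≤1 Σ≤r′ s≡ vert₀ vert₁ (w , 0≤w , w≤1 , d₀≡) =
    conv w 0≤w w≤1
      (ih (λ e → P (⟦ c ⟧ ∷ e)) (conv₀ ⟦ c ⟧) r′
        (λ S S≤ → Convex-resp conv (λ { zero → refl ; (suc i) → refl }) (vert₀ S S≤))
        (p ∷ rest) 0≤e e≤1 Σ≤r′)
      (ih (λ e → P (insert₁ ⟦ c ⟧ e)) (conv₁ ⟦ c ⟧) r′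
        (λ S S≤ → Convex-resp conv (λ { zero → refl ; (suc zero) → refl ; (suc (suc i)) → refl }) (vert₁ S S≤))
        (p ∷ rest) 0≤e e≤1 Σ≤r′)
      (λ { zero → d₀≡ ; (suc zero) → d₁≡ ; (suc (suc i)) → mix-const w (rest i) })
    where
    0≤e : ∀ i → 0ℚ ℚ.≤ (p ∷ rest) i
    0≤e zero    = 0≤p
    0≤e (suc i) = 0≤d (suc (suc i))
    e≤1 : ∀ i → (p ∷ rest) i ℚ.≤ 1ℚ
    e≤1 zero    = p≤1
    e≤1 (suc i) = d≤1 (suc (suc i))
    d₁≡ : d (suc zero) ≡ mix w p ⟦ c ⟧
    d₁≡ = begin
      d (suc zero)                            ≡⟨ solve 2 (λ x y → y := (x :+ y) :- x) refl (d zero) (d (suc zero)) ⟩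
      s ℚ.- d zero                            ≡⟨ cong₂ ℚ._-_ s≡ d₀≡ ⟩
      (⟦ c ⟧ ℚ.+ p) ℚ.- mix w ⟦ c ⟧ p         ≡⟨ solve 3 (λ w c p → (c :+ p) :- (w :* c :+ (con 1ℚ :- w) :* p)
                                                     := w :* p :+ (con 1ℚ :- w) :* c) refl w ⟦ c ⟧ p ⟩
      mix w p ⟦ c ⟧                           ∎
      where open ≡-Reasoning

  flip-mix : ∀ {a p q} → (∃ λ w → 0ℚ ℚ.≤ w × w ℚ.≤ 1ℚ × a ≡ mix w p q) →
             ∃ λ w → 0ℚ ℚ.≤ w × w ℚ.≤ 1ℚ × a ≡ mix w q p
  flip-mix {a} {p} {q} (w , 0≤w , w≤1 , a≡) = 1ℚ ℚ.- w , p≤q⇒0≤q-p w≤1 ,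
    ≤-from-difference w 0≤w (solve 1 (λ w → con 1ℚ := (con 1ℚ :- w) :+ w) refl w) ,
    trans a≡ (solve 3 (λ w p q → w :* p :+ (con 1ℚ :- w) :* q
                 := (con 1ℚ :- w) :* q :+ (con 1ℚ :- (con 1ℚ :- w)) :* p) refl w p q)

  small : s ℚ.≤ 1ℚ → P d
  small s≤1 = shift false s r (+-nonneg (0≤d zero) (0≤d (suc zero))) s≤1
    (subst (ℚ._≤ fromℕ r) (sym (ℚ.+-assoc (d zero) (d (suc zero)) (sumℚ rest))) Σ≤r)
    (sym (ℚ.+-identityˡ s))
    (λ S → vert (false ∷ S))
    (λ S → vert (insert₁ false S))
    (flip-mix (interpolate (0≤d zero) (p≤p+q (0≤d (suc zero)))))

  large : ∀ r → (∀ S → count S ≤ r → P (⟦_⟧ ∘ S)) → sumℚ d ℚ.≤ fromℕ r → 1ℚ ℚ.≤ s → P d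
  large zero vert Σ≤r 1≤s = ⊥-elim (ℚ.<-irrefl refl (ℚ.<-≤-trans (ℚ.positive⁻¹ 1ℚ {{_}})
    (ℚ.≤-trans 1≤s (ℚ.≤-trans (p≤p+q (Σℚ.sum-nonneg (λ i → 0≤d (suc (suc i)))))
      (subst (ℚ._≤ 0ℚ) (sym (ℚ.+-assoc (d zero) (d (suc zero)) (sumℚ rest))) Σ≤r)))))
  large (suc r) vert Σ≤r 1≤s = shift true (s ℚ.- 1ℚ) r (p≤q⇒0≤q-p 1≤s)
    (≤-from-difference ((1ℚ ℚ.- d zero) ℚ.+ (1ℚ ℚ.- d (suc zero)))
      (+-nonneg (p≤q⇒0≤q-p (d≤1 zero)) (p≤q⇒0≤q-p (d≤1 (suc zero))))
      (solve 2 (λ x y → con 1ℚ := ((x :+ y) :- con 1ℚ) :+ ((con 1ℚ :- x) :+ (con 1ℚ :- y))) refl (d zero) (d (suc zero))))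
    (≤-from-difference (fromℕ (suc r) ℚ.- sumℚ d) (p≤q⇒0≤q-p Σ≤r)
      (solve 4 (λ x y z t → t := (((x :+ y) :- con 1ℚ) :+ z) :+ ((con 1ℚ :+ t) :- (x :+ (y :+ z)))) refl
        (d zero) (d (suc zero)) (sumℚ rest) (fromℕ r)))
    (solve 1 (λ s → s := con 1ℚ :+ (s :- con 1ℚ)) refl s)
    (λ S S≤ → vert (true ∷ S) (s≤s S≤))
    (λ S S≤ → vert (insert₁ true S) (ℕ.≤-trans (ℕ.≤-reflexive (ℕ.+-suc _ _)) (s≤s S≤)))
    (interpolate
      (≤-from-difference (1ℚ ℚ.- d (suc zero)) (p≤q⇒0≤q-p (d≤1 (suc zero)))
        (solve 2 (λ x y → x := ((x :+ y) :- con 1ℚ) :+ (con 1ℚ :- y)) refl (d zero) (d (suc zero))))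
      (d≤1 zero))

roundable : ∀ n → Roundable n
roundable zero P conv r vert d _ _ _ = Convex-resp conv (λ ()) (vert (λ ()) z≤n)
roundable (suc zero) P conv zero vert d 0≤d _ Σ≤r =
  Convex-resp conv {⟦_⟧ ∘ λ _ → false} {d}
    (λ { zero → ℚ.≤-antisym (0≤d zero) (subst (ℚ._≤ 0ℚ) (ℚ.+-identityʳ (d zero)) Σ≤r) })
    (vert (λ _ → false) z≤n)
roundable (suc zero) P conv (suc r) vert d 0≤d d≤1 _ =
  conv (d zero) (0≤d zero) (d≤1 zero) (vert (λ _ → true) (s≤s z≤n)) (vert (λ _ → false) z≤n)
    (λ { zero → solve 1 (λ a → a := a :* con 1ℚ :+ (con 1ℚ :- a) :* con 0ℚ) refl (d zero) })
roundable (suc (suc m)) = roundable-step (roundable (suc m))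

-- Fractional matchings

⌊≟⌋-refl : ∀ {n} (i : Fin n) → ⌊ i ≟ i ⌋ ≡ true
⌊≟⌋-refl i with i ≟ i
... | yes _  = refl
... | no i≢i = ⊥-elim (i≢i refl)

⌊≟⌋-≢ : ∀ {n} {i j : Fin n} → i ≢ j → ⌊ i ≟ j ⌋ ≡ false
⌊≟⌋-≢ {i = i} {j} i≢j with i ≟ j
... | yes i≡j = ⊥-elim (i≢j i≡j)
... | no _    = refl

edgeIn-sym : ∀ {G} (F : Deletion G) u v → edgeIn F u v ≡ edgeIn F v u
edgeIn-sym {G} F u v rewrite adj-sym G u v | delE-sym F u v with alive F u | alive F v
... | true  | true  = refl
... | true  | false = refl
... | false | true  = refl
... | false | false = refl

edgeIn-dead : ∀ {G} (F : Deletion G) u v → delV F u ≡ true → edgeIn F u v ≡ false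
edgeIn-dead F u v dead rewrite dead = refl

-- The deficit is taken against the survival indicator, so that it is 0 at deleted vertices and can
-- be summed over all of `Fin (N G)`.
record FracMatching (G : Graph) (F : Deletion G) : Set where
  field
    weight : Fin (N G) → Fin (N G) → ℚ
    w-sym  : ∀ u v → weight u v ≡ weight v u
    w-supp : ∀ u v → edgeIn F u v ≡ false → weight u v ≡ 0ℚ
    w-nonneg : ∀ u v → 0ℚ ℚ.≤ weight u v
  load : Fin (N G) → ℚ
  load v = sumℚ (weight v)
  field
    load≤1 : ∀ v → load v ℚ.≤ 1ℚ
  deficit : Fin (N G) → ℚ
  deficit v = ⟦ alive F v ⟧ ℚ.- load v

open FracMatching

module _ {G : Graph} {F : Deletion G} where

  load-dead : (m : FracMatching G F) → ∀ v → delV F v ≡ true → load m v ≡ 0ℚ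
  load-dead m v dead = Σℚ.sum-ε (λ u → w-supp m v u (edgeIn-dead F v u dead))

  load-nonneg : (m : FracMatching G F) → ∀ v → 0ℚ ℚ.≤ load m v
  load-nonneg m v = Σℚ.sum-nonneg (w-nonneg m v)

  deficit-dead : (m : FracMatching G F) → ∀ v → delV F v ≡ true → deficit m v ≡ 0ℚ
  deficit-dead m v dead rewrite dead | load-dead m v dead = refl

  deficit-nonneg : (m : FracMatching G F) → ∀ v → 0ℚ ℚ.≤ deficit m v
  deficit-nonneg m v with delV F v in eq
  ... | true  rewrite load-dead m v eq = ℚ.≤-refl
  ... | false = p≤q⇒0≤q-p (load≤1 m v)

  deficit≤1 : (m : FracMatching G F) → ∀ v → deficit m v ℚ.≤ 1ℚ
  deficit≤1 m v = ℚ.≤-trans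
    (≤-from-difference (load m v) (load-nonneg m v) (solve 2 (λ a l → a := (a :- l) :+ l) refl ⟦ alive F v ⟧ (load m v)))
    ⟦ alive F v ⟧≤1

  fromPerfect : FracPerfectMatching G F → Σ (FracMatching G F) λ m → ∀ v → deficit m v ≡ 0ℚ
  fromPerfect pm = m , deficit≡0
    where
    open FracPerfectMatching pm
    load≡ : ∀ v → sumℚ (f v) ≡ ⟦ alive F v ⟧
    load≡ v with delV F v in eq
    ... | true  = Σℚ.sum-ε (λ u → f-supp v u (edgeIn-dead F v u eq))
    ... | false = f-sum v (cong not eq)
    ≤1 : ∀ v → sumℚ (f v) ℚ.≤ 1ℚ
    ≤1 v = subst (ℚ._≤ 1ℚ) (sym (load≡ v)) ⟦ alive F v ⟧≤1
    m : FracMatching G F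
    m = record { weight = f ; w-sym = f-sym ; w-supp = f-supp ; w-nonneg = f-nonneg ; load≤1 = ≤1 }
    deficit≡0 : ∀ v → deficit m v ≡ 0ℚ
    deficit≡0 v = trans (cong (λ z → ⟦ alive F v ⟧ ℚ.- z) (load≡ v)) (ℚ.+-inverseʳ ⟦ alive F v ⟧)

  toPerfect : (m : FracMatching G F) → (∀ v → delV F v ≡ false → load m v ≡ 1ℚ) → FracPerfectMatching G F
  toPerfect m full = record
    { f = weight m ; f-sym = w-sym m ; f-supp = w-supp m ; f-nonneg = w-nonneg m
    ; f-le1 = λ u v → ℚ.≤-trans (Σℚ.term≤sum (w-nonneg m u) v) (load≤1 m u)
    ; f-sum = λ v al → full v (trans (sym (Bool.not-involutive _)) (cong not al))
    }

  mixMatching : ∀ w → 0ℚ ℚ.≤ w → w ℚ.≤ 1ℚ → (m m′ : FracMatching G F) →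
                Σ (FracMatching G F) λ m″ → ∀ v → load m″ v ≡ mix w (load m v) (load m′ v)
  mixMatching w 0≤w w≤1 m m′ = record
    { weight = λ u v → mix w (weight m u v) (weight m′ u v)
    ; w-sym = λ u v → cong₂ (mix w) (w-sym m u v) (w-sym m′ u v)
    ; w-supp = λ u v e → trans (cong₂ (mix w) (w-supp m u v e) (w-supp m′ u v e)) (sym (mix-const w 0ℚ))
    ; w-nonneg = λ u v → +-nonneg (*-nonneg 0≤w (w-nonneg m u v)) (*-nonneg 0≤1-w (w-nonneg m′ u v))
    ; load≤1 = λ v → subst (ℚ._≤ 1ℚ) (sym (load-mix v))
        (≤-from-difference (w ℚ.* (1ℚ ℚ.- load m v) ℚ.+ (1ℚ ℚ.- w) ℚ.* (1ℚ ℚ.- load m′ v))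
          (+-nonneg (*-nonneg 0≤w (p≤q⇒0≤q-p (load≤1 m v))) (*-nonneg 0≤1-w (p≤q⇒0≤q-p (load≤1 m′ v))))
          (solve 3 (λ w a b → con 1ℚ := (w :* a :+ (con 1ℚ :- w) :* b) :+ (w :* (con 1ℚ :- a) :+ (con 1ℚ :- w) :* (con 1ℚ :- b)))
             refl w (load m v) (load m′ v)))
    } , load-mix
    where
    0≤1-w : 0ℚ ℚ.≤ 1ℚ ℚ.- w
    0≤1-w = p≤q⇒0≤q-p w≤1
    load-mix : ∀ v → sumℚ (λ u → mix w (weight m v u) (weight m′ v u)) ≡ mix w (load m v) (load m′ v)
    load-mix v = trans (Σℚ.sum-⊕ (λ u → w ℚ.* weight m v u) (λ u → (1ℚ ℚ.- w) ℚ.* weight m′ v u))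
      (cong₂ ℚ._+_ (sumℚ-*ˡ w (weight m v)) (sumℚ-*ˡ (1ℚ ℚ.- w) (weight m′ v)))

module _ {G : Graph} (F : Deletion G) {F′ : Deletion G} (m : FracMatching G F′) where

  lost : Fin (N G) → Fin (N G) → ℚ
  lost u v = if edgeIn F u v then 0ℚ else weight m u v

  private
    kept : Fin (N G) → Fin (N G) → ℚ
    kept u v = if edgeIn F u v then weight m u v else 0ℚ

    kept≤ : ∀ u v → kept u v ℚ.≤ weight m u v
    kept≤ u v with edgeIn F u v
    ... | true  = ℚ.≤-refl
    ... | false = w-nonneg m u v

    0≤kept : ∀ u v → 0ℚ ℚ.≤ kept u v
    0≤kept u v with edgeIn F u v
    ... | true  = w-nonneg m u v
    ... | false = ℚ.≤-refl

    kept-sym : ∀ u v → kept u v ≡ kept v u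
    kept-sym u v rewrite edgeIn-sym F u v with edgeIn F v u
    ... | true  = w-sym m u v
    ... | false = refl

    kept-supp : ∀ u v → edgeIn F u v ≡ false → kept u v ≡ 0ℚ
    kept-supp u v e rewrite e = refl

  lost≤weight : ∀ u v → lost u v ℚ.≤ weight m u v
  lost≤weight u v with edgeIn F u v
  ... | true  = w-nonneg m u v
  ... | false = ℚ.≤-refl

  lost-zero : ∀ u v → edgeIn F u v ≡ edgeIn F′ u v → lost u v ≡ 0ℚ
  lost-zero u v same with edgeIn F u v
  ... | true  = refl
  ... | false = w-supp m u v (sym same)

  restrict : FracMatching G F
  restrict = record
    { weight = kept ; w-sym = kept-sym ; w-supp = kept-supp ; w-nonneg = 0≤kept
    ; load≤1 = λ v → ℚ.≤-trans (Σℚ.sum-mono (kept≤ v)) (load≤1 m v) }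

  -- At a surviving vertex the old load splits into kept and lost weight, so the deficit grows by
  -- the lost part, which `ρ` bounds. At a deleted vertex the new deficit is 0.
  deficit-restrict : ∀ v → (delV F v ≡ false → delV F′ v ≡ false) → {ρ : Fin (N G) → ℚ} →
                     (∀ u → 0ℚ ℚ.≤ ρ u) → (delV F v ≡ false → ∀ u → lost v u ℚ.≤ ρ u) →
                     deficit restrict v ℚ.≤ deficit m v ℚ.+ sumℚ ρ
  deficit-restrict v stays {ρ} 0≤ρ lost≤ρ = go (delV F v) refl
    where
    go : ∀ b → delV F v ≡ b → deficit restrict v ℚ.≤ deficit m v ℚ.+ sumℚ ρ
    go true  eq = subst (ℚ._≤ _) (sym (deficit-dead restrict v eq)) (+-nonneg (deficit-nonneg m v) (Σℚ.sum-nonneg 0≤ρ))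
    go false eq = subst₂ (λ a b → ⟦ not a ⟧ ℚ.- load restrict v ℚ.≤ (⟦ not b ⟧ ℚ.- load m v) ℚ.+ sumℚ ρ)
      (sym eq) (sym (stays eq)) (≤-from-difference (sumℚ ρ ℚ.- sumℚ (lost v))
      (p≤q⇒0≤q-p (Σℚ.sum-mono (lost≤ρ eq)))
      (trans (cong (λ l → (1ℚ ℚ.- l) ℚ.+ sumℚ ρ) load≡)
        (solve 3 (λ k l r → (con 1ℚ :- (k :+ l)) :+ r := (con 1ℚ :- k) :+ (r :- l)) refl (sumℚ (kept v)) (sumℚ (lost v)) (sumℚ ρ))))
      where
      kept+lost : ∀ u → weight m v u ≡ kept v u ℚ.+ lost v u
      kept+lost u with edgeIn F v u
      ... | true  = sym (ℚ.+-identityʳ _)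
      ... | false = sym (ℚ.+-identityˡ _)
      load≡ : load m v ≡ sumℚ (kept v) ℚ.+ sumℚ (lost v)
      load≡ = trans (Σℚ.sum-cong kept+lost) (Σℚ.sum-⊕ (kept v) (lost v))

0≤if : ∀ b {a} → 0ℚ ℚ.≤ a → 0ℚ ℚ.≤ (if b then a else 0ℚ)
0≤if true  0≤a = 0≤a
0≤if false _   = ℚ.≤-refl

restoreV : ∀ {G} → Deletion G → Fin (N G) → Deletion G
restoreV F w = record
  { delV = λ v → delV F v ∧ not ⌊ v ≟ w ⌋
  ; delE = delE F ; delE-sym = delE-sym F ; delE-adj = delE-adj F }

-- Deleting `w` again takes from a surviving vertex only its edge to `w`.
deficit-restoreV : ∀ {G} (F : Deletion G) w → delV F w ≡ true → (m : FracMatching G (restoreV F w)) →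
                   ∀ v → deficit (restrict F m) v ℚ.≤ deficit m v ℚ.+ weight m v w
deficit-restoreV {G} F w w-del m v =
  subst (λ z → deficit (restrict F m) v ℚ.≤ deficit m v ℚ.+ z) (Σℚ.sum-indicator w (weight m v w))
    (deficit-restrict F m v (λ eq → cong (_∧ not ⌊ v ≟ w ⌋) eq)
      (λ u → 0≤if ⌊ w ≟ u ⌋ (w-nonneg m v w)) bound)
  where
  bound : delV F v ≡ false → ∀ u → lost F m v u ℚ.≤ (if ⌊ w ≟ u ⌋ then weight m v w else 0ℚ)
  bound al u with w ≟ u
  ... | yes refl = lost≤weight F m v w
  ... | no w≢u   = ℚ.≤-reflexive (lost-zero F m v u same)
    where
    same : edgeIn F v u ≡ edgeIn (restoreV F w) v u
    same rewrite al | ⌊≟⌋-≢ (w≢u ∘ sym) | Bool.∧-identityʳ (delV F u) = refl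

isEdge : ∀ {n} → Fin n → Fin n → Fin n → Fin n → Bool
isEdge p q u v = (⌊ p ≟ u ⌋ ∧ ⌊ q ≟ v ⌋) ∨ (⌊ p ≟ v ⌋ ∧ ⌊ q ≟ u ⌋)

restoreE : ∀ {G} → Deletion G → Fin (N G) → Fin (N G) → Deletion G
restoreE F p q = record
  { delV = delV F
  ; delE = λ u v → delE F u v ∧ not (isEdge p q u v)
  ; delE-sym = λ u v → cong₂ (λ a b → a ∧ not b) (delE-sym F u v) (Bool.∨-comm (⌊ p ≟ u ⌋ ∧ ⌊ q ≟ v ⌋) _)
  ; delE-adj = λ u v eq → delE-adj F u v (proj₁ (∧-true (delE F u v) eq)) }
  where
  ∧-true : ∀ a {b} → a ∧ b ≡ true → a ≡ true × b ≡ true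
  ∧-true true eq = refl , eq

deficit-restoreE : ∀ {G} (F : Deletion G) p q (m : FracMatching G (restoreE F p q)) → ∀ v →
                   deficit (restrict F m) v ℚ.≤
                   deficit m v ℚ.+ ((if ⌊ p ≟ v ⌋ then weight m p q else 0ℚ) ℚ.+ (if ⌊ q ≟ v ⌋ then weight m q p else 0ℚ))
deficit-restoreE {G} F p q m v =
  subst (λ z → deficit (restrict F m) v ℚ.≤ deficit m v ℚ.+ z)
    (trans (Σℚ.sum-⊕ (λ u → if ⌊ q ≟ u ⌋ then α else 0ℚ) _)
      (cong₂ ℚ._+_ (Σℚ.sum-indicator q α) (Σℚ.sum-indicator p β)))
    (deficit-restrict F m v (λ eq → eq)
      (λ u → +-nonneg (0≤if ⌊ q ≟ u ⌋ 0≤α) (0≤if ⌊ p ≟ u ⌋ 0≤β)) (λ _ → bound))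
  where
  α = if ⌊ p ≟ v ⌋ then weight m p q else 0ℚ
  β = if ⌊ q ≟ v ⌋ then weight m q p else 0ℚ
  0≤α : 0ℚ ℚ.≤ α
  0≤α = 0≤if ⌊ p ≟ v ⌋ (w-nonneg m p q)
  0≤β : 0ℚ ℚ.≤ β
  0≤β = 0≤if ⌊ q ≟ v ⌋ (w-nonneg m q p)
  bound : ∀ u → lost F m v u ℚ.≤ (if ⌊ q ≟ u ⌋ then α else 0ℚ) ℚ.+ (if ⌊ p ≟ u ⌋ then β else 0ℚ)
  bound u with isEdge p q v u in eq
  ... | false = subst (ℚ._≤ _) (sym (lost-zero F m v u same))
                  (+-nonneg (0≤if ⌊ q ≟ u ⌋ 0≤α) (0≤if ⌊ p ≟ u ⌋ 0≤β))
    where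
    same : edgeIn F v u ≡ edgeIn (restoreE F p q) v u
    same rewrite eq | Bool.∧-identityʳ (delE F v u) = refl
  -- The equation `eq` leaves only the two orientations of the restored edge.
  ... | true with p ≟ v | q ≟ u | p ≟ u | q ≟ v
  ...   | yes refl | yes refl | d | e = ℚ.≤-trans (lost≤weight F m p q)
            (p≤p+q (0≤if ⌊ d ⌋ (0≤if ⌊ e ⌋ (w-nonneg m q p))))
  ...   | d | e | yes refl | yes refl = ℚ.≤-trans (lost≤weight F m q p)
            (subst (weight m q p ℚ.≤_) (ℚ.+-comm (weight m q p) _)
              (p≤p+q (0≤if ⌊ e ⌋ (0≤if ⌊ d ⌋ (w-nonneg m p q)))))

-- Restoring faults

if-true : ∀ b → 1 ≤ (if b then 1 else 0) → b ≡ true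
if-true true _ = refl

sumℕ-positive : ∀ {n} (f : Fin n → ℕ) → 1 ≤ sumℕ f → ∃ λ i → 1 ≤ f i
sumℕ-positive {suc n} f 1≤ with f zero in eq
... | suc k = zero , subst (1 ≤_) (sym eq) (s≤s z≤n)
... | zero with sumℕ-positive (f ∘ suc) 1≤
...   | i , 1≤fi = suc i , 1≤fi

count-positive : ∀ {n} (S : Fin n → Bool) → 1 ≤ count S → ∃ λ i → S i ≡ true
count-positive S 1≤ with sumℕ-positive (λ i → if S i then 1 else 0) 1≤
... | i , 1≤Si = i , if-true (S i) 1≤Si

count-update : ∀ {n} (S S′ : Fin n → Bool) i → (∀ j → j ≢ i → S j ≡ S′ j) →
               count S + (if S′ i then 1 else 0) ≡ count S′ + (if S i then 1 else 0)
count-update S S′ i agree = Σℕ.sum-update _ _ i (λ j j≢i → cong (if_then 1 else 0) (agree j j≢i))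

upper : ∀ {G} → Deletion G → Fin (N G) → Fin (N G) → Bool
upper F u v = (toℕ u <ᵇ toℕ v) ∧ delE F u v

size-restoreV : ∀ {G} (F : Deletion G) w → delV F w ≡ true → size F ≡ suc (size (restoreV F w))
size-restoreV F w w-del = cong (_+ sumℕ (λ u → count (upper F u))) count≡
  where
  agree : ∀ j → j ≢ w → delV F j ≡ delV F j ∧ not ⌊ j ≟ w ⌋
  agree j j≢w rewrite ⌊≟⌋-≢ j≢w = sym (Bool.∧-identityʳ (delV F j))
  count≡ : count (delV F) ≡ suc (count (delV (restoreV F w)))
  count≡ with count-update (delV F) (delV (restoreV F w)) w agree
  ... | eq rewrite w-del | ⌊≟⌋-refl w = trans (sym (ℕ.+-identityʳ _)) (trans eq (ℕ.+-comm _ 1))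

<ᵇ-true : ∀ {m n} → m < n → (m <ᵇ n) ≡ true
<ᵇ-true {m} {n} m<n with m <ᵇ n | ℕ.<⇒<ᵇ m<n
... | true | _ = refl

<ᵇ-false : ∀ {m n} → n < m → (m <ᵇ n) ≡ false
<ᵇ-false {m} {n} n<m with m <ᵇ n in eq
... | false = refl
... | true  = ⊥-elim (ℕ.<-asym n<m (ℕ.<ᵇ⇒< m n (subst T (sym eq) _)))

-- Restoring the edge also changes `delE` at the reversed pair, but the order test already hides
-- that entry, so `upper` changes in one place only.
upper-restoreE : ∀ {G} (F : Deletion G) p q → toℕ p < toℕ q → ∀ u v → ¬ (p ≡ u × q ≡ v) →
                 upper F u v ≡ upper (restoreE F p q) u v
upper-restoreE F p q p<q u v ≢pq with p ≟ u | q ≟ v | p ≟ v | q ≟ u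
... | yes p≡u  | yes q≡v  | _        | _        = ⊥-elim (≢pq (p≡u , q≡v))
... | no _     | _        | yes refl | yes refl rewrite <ᵇ-false p<q = refl
... | yes _    | no _     | yes refl | yes refl rewrite <ᵇ-false p<q = refl
... | no _     | _        | yes _    | no _     = cong ((toℕ u <ᵇ toℕ v) ∧_) (sym (Bool.∧-identityʳ _))
... | no _     | _        | no _     | _        = cong ((toℕ u <ᵇ toℕ v) ∧_) (sym (Bool.∧-identityʳ _))
... | yes _    | no _     | yes _    | no _     = cong ((toℕ u <ᵇ toℕ v) ∧_) (sym (Bool.∧-identityʳ _))
... | yes _    | no _     | no _     | _        = cong ((toℕ u <ᵇ toℕ v) ∧_) (sym (Bool.∧-identityʳ _))

-- The indicator also covers pairs that are not deleted, as occurs when `someOtherFault` restores a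
-- prescribed pair.
size-restoreE : ∀ {G} (F : Deletion G) p q → toℕ p < toℕ q →
                size F ≡ size (restoreE F p q) + (if delE F p q then 1 else 0)
size-restoreE F p q p<q = trans (cong (count (delV F) +_) edges≡) (sym (ℕ.+-assoc (count (delV F)) _ _))
  where
  F′ = restoreE F p q
  row row′ : _ → ℕ
  row u = count (upper F u)
  row′ u = count (upper F′ u)
  row≡ : row p ≡ row′ p + (if delE F p q then 1 else 0)
  row≡ with count-update (upper F p) (upper F′ p) q
              (λ v v≢q → upper-restoreE F p q p<q p v (λ (_ , q≡v) → v≢q (sym q≡v)))
  ... | eq rewrite <ᵇ-true p<q | ⌊≟⌋-refl p | ⌊≟⌋-refl q | Bool.∧-zeroʳ (delE F p q) =
    trans (sym (ℕ.+-identityʳ _)) eq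
  edges≡ : sumℕ row ≡ sumℕ row′ + (if delE F p q then 1 else 0)
  -- `sum-update` over the rows puts `row′ p` on both sides, where it cancels.
  edges≡ = ℕ.+-cancelʳ-≡ (row′ p) _ _ (begin
    sumℕ row + row′ p     ≡⟨ Σℕ.sum-update row row′ p (λ u u≢p → Σℕ.sum-cong (λ v → cong (if_then 1 else 0)
                               (upper-restoreE F p q p<q u v (λ (p≡u , _) → u≢p (sym p≡u))))) ⟩
    sumℕ row′ + row p     ≡⟨ cong (sumℕ row′ +_) (trans row≡ (ℕ.+-comm (row′ p) _)) ⟩
    sumℕ row′ + (_ + row′ p) ≡⟨ ℕ.+-assoc (sumℕ row′) _ _ ⟨
    sumℕ row′ + _ + row′ p ∎)
    where open ≡-Reasoning

data Fault {G} (F : Deletion G) : Set where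
  vertex : ∀ w → delV F w ≡ true → Fault F
  edge   : ∀ p q → toℕ p < toℕ q → delE F p q ≡ true → Fault F

restore : ∀ {G} (F : Deletion G) → Fault F → Deletion G
restore F (vertex w _)   = restoreV F w
restore F (edge p q _ _) = restoreE F p q

size-restore : ∀ {G} (F : Deletion G) (x : Fault F) → size F ≡ suc (size (restore F x))
size-restore F (vertex w w-del) = size-restoreV F w w-del
size-restore F (edge p q p<q pq-del) with size-restoreE F p q p<q
... | eq rewrite pq-del = trans eq (ℕ.+-comm _ 1)

someFault : ∀ {G} (F : Deletion G) → 1 ≤ size F → Fault F
someFault F 1≤ with count (delV F) in eq
... | suc _ with count-positive (delV F) (subst (1 ≤_) (sym eq) (s≤s z≤n))
...   | w , w-del = vertex w w-del
someFault F 1≤ | zero with sumℕ-positive _ 1≤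
...   | p , 1≤row with count-positive (upper F p) 1≤row
...     | q , up with toℕ p <ᵇ toℕ q in lt
...       | true = edge p q (ℕ.<ᵇ⇒< (toℕ p) (toℕ q) (subst T (sym lt) _)) up

weight≤1 : ∀ {G} {F : Deletion G} (m : FracMatching G F) u v → weight m u v ℚ.≤ 1ℚ
weight≤1 m u v = ℚ.≤-trans (Σℚ.term≤sum (w-nonneg m u) v) (load≤1 m u)

total : ∀ {G F} → FracMatching G F → ℚ
total m = sumℚ (deficit m)

-- Losing a vertex costs its neighbours at most its load, hence at most 1. Losing an edge costs its
-- weight at both ends, hence at most 2.
total-restore : ∀ {G} (F : Deletion G) (x : Fault F) (m : FracMatching G (restore F x)) →
                total (restrict F m) ℚ.≤ total m ℚ.+ fromℕ 2
total-restore F (vertex w w-del) m = ℚ.≤-trans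
  (Σℚ.sum-mono (deficit-restoreV F w w-del m))
  (subst (ℚ._≤ total m ℚ.+ fromℕ 2) (sym (Σℚ.sum-⊕ (deficit m) (λ v → weight m v w)))
    (ℚ.+-monoʳ-≤ (total m) (ℚ.≤-trans (ℚ.≤-reflexive (Σℚ.sum-cong (λ v → w-sym m v w)))
      (ℚ.≤-trans (load≤1 m w) (p≤p+q 0≤1)))))
total-restore F (edge p q _ _) m = ℚ.≤-trans
  (Σℚ.sum-mono (deficit-restoreE F p q m))
  (subst (ℚ._≤ total m ℚ.+ fromℕ 2) (sym (trans (Σℚ.sum-⊕ (deficit m) _) (cong (total m ℚ.+_) ρ≡)))
    (ℚ.+-monoʳ-≤ (total m) (ℚ.+-mono-≤ (weight≤1 m p q) (weight≤1 m q p))))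
  where
  ρ≡ : _ ≡ weight m p q ℚ.+ weight m q p
  ρ≡ = trans (Σℚ.sum-⊕ (λ v → if ⌊ p ≟ v ⌋ then weight m p q else 0ℚ) _)
         (cong₂ ℚ._+_ (Σℚ.sum-indicator p _) (Σℚ.sum-indicator q _))

-- The excluded fault is the edge joining `x` and `y`: if it carried weight 1, losing it would leave
-- deficit 1 at both ends.
Avoids : ∀ {G} {F : Deletion G} → Fin (N G) → Fin (N G) → Fault F → Set
Avoids x y (vertex _ _)   = ⊤
Avoids x y (edge p q _ _) = ¬ (p ≡ x × q ≡ y) × ¬ (q ≡ x × p ≡ y)

-- Restoring the pair `x`, `y` first removes at most one fault. Any fault still present is a fault
-- of `F` and is not that edge.
someOtherFault : ∀ {G} (F : Deletion G) x y → toℕ x < toℕ y → 2 ≤ size F → Σ (Fault F) (Avoids x y)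
someOtherFault F x y x<y 2≤ with someFault (restoreE F x y) 1≤size
  where
  one : ∀ b → (if b then 1 else 0) ≤ 1
  one true  = ℕ.≤-refl
  one false = z≤n
  1≤size : 1 ≤ size (restoreE F x y)
  1≤size = ℕ.+-cancelʳ-≤ 1 1 _ (ℕ.≤-trans 2≤ (ℕ.≤-trans (ℕ.≤-reflexive (size-restoreE F x y x<y))
    (ℕ.+-monoʳ-≤ (size (restoreE F x y)) (one (delE F x y)))))
... | vertex w w-del = vertex w w-del , _
... | edge p q p<q pq-del with delE F p q in eq
...   | true = edge p q p<q eq , avoid₁ , avoid₂
  where
  isEdge-on : isEdge p q p q ≡ true
  isEdge-on rewrite ⌊≟⌋-refl p | ⌊≟⌋-refl q = refl
  isEdge-reverse : isEdge q p p q ≡ true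
  isEdge-reverse rewrite ⌊≟⌋-refl p | ⌊≟⌋-refl q = Bool.∨-zeroʳ (⌊ q ≟ p ⌋ ∧ ⌊ p ≟ q ⌋)
  not-restored : isEdge x y p q ≢ true
  not-restored is-xy = Bool.not-¬ (cong not is-xy) pq-del
  avoid₁ : ¬ (p ≡ x × q ≡ y)
  avoid₁ (refl , refl) = not-restored isEdge-on
  avoid₂ : ¬ (q ≡ x × p ≡ y)
  avoid₂ (refl , refl) = not-restored isEdge-reverse

-- For a restored vertex both deficits come out of its load, which is at most 1. A restored edge
-- other than the one between `x` and `y` has at most one end among them.
pair-deficit : ∀ {G} (F : Deletion G) (f : Fault F) x y → x ≢ y → Avoids x y f →
               (m : FracMatching G (restore F f)) → (∀ v → deficit m v ≡ 0ℚ) →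
               deficit (restrict F m) x ℚ.+ deficit (restrict F m) y ℚ.≤ 1ℚ
pair-deficit F (vertex w w-del) x y x≢y _ m full = ℚ.≤-trans (ℚ.+-mono-≤ (bound x) (bound y))
  (ℚ.≤-trans (Σℚ.two-terms≤sum (w-nonneg m w) x y x≢y) (load≤1 m w))
  where
  bound : ∀ v → deficit (restrict F m) v ℚ.≤ weight m w v
  bound v = subst (deficit (restrict F m) v ℚ.≤_)
    (trans (cong₂ ℚ._+_ (full v) (w-sym m v w)) (ℚ.+-identityˡ _)) (deficit-restoreV F w w-del m v)
pair-deficit F (edge p q p<q _) x y x≢y (≢xy , ≢yx) m full = ℚ.≤-trans (ℚ.+-mono-≤ (bound x) (bound y)) disjoint
  where
  α = weight m p q
  β = weight m q p
  ρ : _ → ℚ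
  ρ v = (if ⌊ p ≟ v ⌋ then α else 0ℚ) ℚ.+ (if ⌊ q ≟ v ⌋ then β else 0ℚ)
  bound : ∀ v → deficit (restrict F m) v ℚ.≤ ρ v
  bound v = subst (deficit (restrict F m) v ℚ.≤_)
    (trans (cong (ℚ._+ ρ v) (full v)) (ℚ.+-identityˡ _)) (deficit-restoreE F p q m v)
  p≢q : p ≢ q
  p≢q refl = ℕ.<-irrefl refl p<q
  disjoint : ρ x ℚ.+ ρ y ℚ.≤ 1ℚ
  -- At most one comparison succeeds, because `p ≢ q`, `x ≢ y` and the edge is not the pair `x`,
  -- `y`.
  disjoint with p ≟ x | q ≟ x | p ≟ y | q ≟ y
  ... | yes p≡x | yes q≡x | _       | _       = ⊥-elim (p≢q (trans p≡x (sym q≡x)))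
  ... | _       | _       | yes p≡y | yes q≡y = ⊥-elim (p≢q (trans p≡y (sym q≡y)))
  ... | yes p≡x | _       | yes p≡y | _       = ⊥-elim (x≢y (trans (sym p≡x) p≡y))
  ... | _       | yes q≡x | _       | yes q≡y = ⊥-elim (x≢y (trans (sym q≡x) q≡y))
  ... | yes p≡x | _       | _       | yes q≡y = ⊥-elim (≢xy (p≡x , q≡y))
  ... | _       | yes q≡x | yes p≡y | _       = ⊥-elim (≢yx (q≡x , p≡y))
  ... | yes _   | no _    | no _    | no _    = subst (ℚ._≤ 1ℚ)
    (solve 1 (λ a → a := (a :+ con 0ℚ) :+ (con 0ℚ :+ con 0ℚ)) refl α) (weight≤1 m p q)
  ... | no _    | yes _   | no _    | no _    = subst (ℚ._≤ 1ℚ)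
    (solve 1 (λ a → a := (con 0ℚ :+ a) :+ (con 0ℚ :+ con 0ℚ)) refl β) (weight≤1 m q p)
  ... | no _    | no _    | yes _   | no _    = subst (ℚ._≤ 1ℚ)
    (solve 1 (λ a → a := (con 0ℚ :+ con 0ℚ) :+ (a :+ con 0ℚ)) refl α) (weight≤1 m p q)
  ... | no _    | no _    | no _    | yes _   = subst (ℚ._≤ 1ℚ)
    (solve 1 (λ a → a := (con 0ℚ :+ con 0ℚ) :+ (con 0ℚ :+ a)) refl β) (weight≤1 m q p)
  ... | no _    | no _    | no _    | no _    = 0≤1

-- Nearly perfect matchings beyond the tolerated number of faults

total-perfect : ∀ {G} {F : Deletion G} (m : FracMatching G F) → (∀ v → deficit m v ≡ 0ℚ) → total m ≡ 0ℚ
total-perfect m full = Σℚ.sum-ε full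

-- The lower-bound half of `FsmpEq`, contraposed. Since `IsFSMPSet` is itself a negation, the
-- contrapositive yields a doubly negated matching.
Robust : Graph → ℕ → Set
Robust G k = ∀ (F : Deletion G) → size F < k → ¬ ¬ FracPerfectMatching G F

module _ {G : Graph} {k : ℕ} (robust : Robust G k) where

  perfect : ∀ F → size F < k → ¬ ¬ Σ (FracMatching G F) λ m → ∀ v → deficit m v ≡ 0ℚ
  perfect F F<k no-m = robust F F<k (no-m ∘ fromPerfect)

  -- Induction on the excess `j`: each restored fault lowers the size by one and, when deleted
  -- again, adds at most 2 to the total deficit.
  nearlyPerfect : 1 ≤ k → ∀ j F → size F < k + j → ¬ ¬ Σ (FracMatching G F) λ m → total m ℚ.≤ fromℕ (j * 2)
  nearlyPerfect 1≤k zero F F<k no-m = perfect F (subst (size F <_) (ℕ.+-identityʳ k) F<k)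
    λ (m , full) → no-m (m , ℚ.≤-reflexive (total-perfect m full))
  nearlyPerfect 1≤k (suc j) F F<k no-m with size F ℕ.<? k
  ... | yes F<k′ = perfect F F<k′
    λ (m , full) → no-m (m , subst (ℚ._≤ fromℕ (suc j * 2)) (sym (total-perfect m full)) (0≤fromℕ (suc j * 2)))
  ... | no F≮k = nearlyPerfect 1≤k j (restore F f)
      (ℕ.≤-pred (subst₂ _≤_ (cong suc (size-restore F f)) (ℕ.+-suc k j) F<k))
      λ (m , total≤) → no-m (restrict F m , ℚ.≤-trans (total-restore F f m)
        (subst (total m ℚ.+ fromℕ 2 ℚ.≤_)
          (solve 1 (λ t → t :+ con (fromℕ 2) := con 1ℚ :+ (con 1ℚ :+ t)) refl (fromℕ (j * 2)))
          (ℚ.+-monoˡ-≤ (fromℕ 2) total≤)))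
    where
    f : Fault F
    f = someFault F (ℕ.≤-trans 1≤k (ℕ.≮⇒≥ F≮k))

  -- The joint bound is for two vertices that will send their deficits to the same vertex of the
  -- other half, which can absorb at most 1.
  NearlyPerfectAt : Deletion G → Fin (N G) → Fin (N G) → Set
  NearlyPerfectAt F x y = Σ (FracMatching G F) λ m → total m ℚ.≤ fromℕ 2 × deficit m x ℚ.+ deficit m y ℚ.≤ 1ℚ

  nearlyPerfectAt-< : 2 ≤ k → ∀ F → size F ≡ k → ∀ x y → toℕ x < toℕ y → ¬ ¬ NearlyPerfectAt F x y
  nearlyPerfectAt-< 2≤k F F≡k x y x<y no-m with someOtherFault F x y x<y (subst (2 ≤_) (sym F≡k) 2≤k)
  ... | f , avoids = perfect (restore F f) (ℕ.≤-reflexive (trans (sym (size-restore F f)) F≡k))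
    λ (m , full) → no-m (restrict F m ,
      ℚ.≤-trans (total-restore F f m)
        (ℚ.≤-reflexive (trans (cong (ℚ._+ fromℕ 2) (total-perfect m full)) (ℚ.+-identityˡ _))) ,
      pair-deficit F f x y (λ x≡y → ℕ.<-irrefl (cong toℕ x≡y) x<y) avoids m full)

  nearlyPerfectAt : 2 ≤ k → ∀ F → size F ≡ k → ∀ x y → x ≢ y → ¬ ¬ NearlyPerfectAt F x y
  -- Edges are counted through their increasing pair, so the two vertices are first put in order.
  nearlyPerfectAt 2≤k F F≡k x y x≢y no-m with ℕ.<-cmp (toℕ x) (toℕ y)
  ... | tri< x<y _ _ = nearlyPerfectAt-< 2≤k F F≡k x y x<y no-m
  ... | tri≈ _ x≡y _ = x≢y (Fin.toℕ-injective x≡y)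
  ... | tri> _ _ y<x = nearlyPerfectAt-< 2≤k F F≡k y x y<x
    λ (m , total≤ , yx≤1) → no-m (m , total≤ , subst (ℚ._≤ 1ℚ) (ℚ.+-comm (deficit m y) (deficit m x)) yx≤1)

load-full : ∀ {G F} (m : FracMatching G F) v → deficit m v ≡ 0ℚ → load m v ≡ ⟦ alive F v ⟧
load-full {F = F} m v full = begin
  load m v                             ≡⟨ solve 2 (λ a l → l := a :- (a :- l)) refl ⟦ alive F v ⟧ (load m v) ⟩
  ⟦ alive F v ⟧ ℚ.- deficit m v        ≡⟨ cong (λ z → ⟦ alive F v ⟧ ℚ.- z) full ⟩
  ⟦ alive F v ⟧ ℚ.- 0ℚ                 ≡⟨ ℚ.+-identityʳ _ ⟩
  ⟦ alive F v ⟧                        ∎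
  where open ≡-Reasoning

-- Matchings with prescribed demands

deleteAlso : ∀ {G} → Deletion G → (Fin (N G) → Bool) → Deletion G
deleteAlso F S = record
  { delV = λ v → delV F v ∨ S v ; delE = delE F ; delE-sym = delE-sym F ; delE-adj = delE-adj F }

size-deleteAlso : ∀ {G} (F : Deletion G) S → size (deleteAlso F S) ≤ count S + size F
size-deleteAlso F S = ℕ.≤-trans (ℕ.+-monoˡ-≤ E count≤) (ℕ.≤-reflexive (ℕ.+-assoc (count S) _ E))
  where
  E = sumℕ (λ u → count (upper F u))
  count≤ : count (λ v → delV F v ∨ S v) ≤ count S + count (delV F)
  count≤ = ℕ.≤-trans (Σℕ.sum-mono (λ v → or≤ (delV F v) (S v)))
    (ℕ.≤-reflexive (Σℕ.sum-⊕ (λ v → if S v then 1 else 0) (λ v → if delV F v then 1 else 0)))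
    where
    or≤ : ∀ a b → (if a ∨ b then 1 else 0) ≤ (if b then 1 else 0) + (if a then 1 else 0)
    or≤ true  b     = ℕ.m≤n+m 1 _
    or≤ false true  = s≤s z≤n
    or≤ false false = z≤n

module _ {G : Graph} {k : ℕ} (robust : Robust G k) (F : Deletion G) where

  -- Here `e v` is the amount that a surviving `v` receives from the other half, leaving `1 - e v`
  -- to be matched inside.
  Matchable : (Fin (N G) → ℚ) → Set
  Matchable e = ¬ ¬ Σ (FracMatching G F) λ m → ∀ v → load m v ≡ ⟦ alive F v ⟧ ℚ.* (1ℚ ℚ.- e v)

  -- The prescribed load is affine in `e`, so mixing two matchings realises the mixed demand.
  matchable-convex : Convex Matchable
  matchable-convex {x} {y} {z} w 0≤w w≤1 mx my z≡ no-m =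
    mx λ (m , load≡) → my λ (m′ , load≡′) →
      let (m″ , load≡″) = mixMatching w 0≤w w≤1 m m′ in
      no-m (m″ , λ v → begin
        load m″ v                               ≡⟨ load≡″ v ⟩
        mix w (load m v) (load m′ v)            ≡⟨ cong₂ (mix w) (load≡ v) (load≡′ v) ⟩
        mix w (⟦ alive F v ⟧ ℚ.* (1ℚ ℚ.- x v)) (⟦ alive F v ⟧ ℚ.* (1ℚ ℚ.- y v))
          ≡⟨ solve 4 (λ w a x y → w :* (a :* (con 1ℚ :- x)) :+ (con 1ℚ :- w) :* (a :* (con 1ℚ :- y))
               := a :* (con 1ℚ :- (w :* x :+ (con 1ℚ :- w) :* y))) refl w ⟦ alive F v ⟧ (x v) (y v) ⟩
        ⟦ alive F v ⟧ ℚ.* (1ℚ ℚ.- mix w (x v) (y v))   ≡⟨ cong (λ t → ⟦ alive F v ⟧ ℚ.* (1ℚ ℚ.- t)) (z≡ v) ⟨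
        ⟦ alive F v ⟧ ℚ.* (1ℚ ℚ.- z v)          ∎)
    where open ≡-Reasoning

  -- A perfect matching after deleting `S` as well has load 0 on `S` and 1 on the other survivors,
  -- as the indicator of `S` demands.
  matchable-vertex : ∀ S → count S + size F < k → Matchable (⟦_⟧ ∘ S)
  matchable-vertex S S+F<k no-m = perfect robust F′ (ℕ.≤-<-trans (size-deleteAlso F S) S+F<k)
    λ (m , full) → no-m (record
      { weight = weight m ; w-sym = w-sym m ; w-supp = λ u v e → w-supp m u v (edgeIn-less u v e)
      ; w-nonneg = w-nonneg m ; load≤1 = load≤1 m }
      , λ v → trans (load-full m v (full v)) (split (delV F v) (S v)))
    where
    F′ = deleteAlso F S
    edgeIn-less : ∀ u v → edgeIn F u v ≡ false → edgeIn F′ u v ≡ false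
    edgeIn-less u v e with delV F u | delV F v | S u | S v
    ... | true  | _     | _     | _     = refl
    ... | false | _     | true  | _     = refl
    ... | false | true  | false | _     = refl
    ... | false | false | false | true  = refl
    ... | false | false | false | false = e
    split : ∀ a b → ⟦ not (a ∨ b) ⟧ ≡ ⟦ not a ⟧ ℚ.* (1ℚ ℚ.- ⟦ b ⟧)
    split true  true  = refl
    split true  false = refl
    split false true  = refl
    split false false = refl

  -- Rounding reduces `e` to indicators of at most `r` vertices, whose further deletion is within
  -- the tolerance `k`.
  matchable : ∀ r → r + size F < k → ∀ e → (∀ v → 0ℚ ℚ.≤ e v) → (∀ v → e v ℚ.≤ 1ℚ) →
              sumℚ e ℚ.≤ fromℕ r → Matchable e
  matchable r r+F<k = roundable (N G) Matchable matchable-convex r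
    (λ S S≤r → matchable-vertex S (ℕ.≤-<-trans (ℕ.+-monoˡ-≤ (size F) S≤r) r+F<k))

-- Matchings across the two halves

-- A fractional perfect matching of the combined graph cut along its halves: the cross weights fill
-- exactly the deficits of the two inner matchings.
record Split {G₁ G₂ : Graph} (F₁ : Deletion G₁) (F₂ : Deletion G₂) (Link : Fin (N G₁) → Fin (N G₂) → Set) : Set where
  field
    cross    : Fin (N G₁) → Fin (N G₂) → ℚ
    x-nonneg : ∀ x y → 0ℚ ℚ.≤ cross x y
    x-supp   : ∀ x y → cross x y ≡ 0ℚ ⊎ (delV F₁ x ≡ false × delV F₂ y ≡ false × Link x y)
    left     : FracMatching G₁ F₁
    right    : FracMatching G₂ F₂
    x-left   : ∀ x → sumℚ (cross x) ≡ deficit left x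
    x-right  : ∀ y → sumℚ (λ x → cross x y) ≡ deficit right y

transposeSplit : ∀ {G₁ G₂} {F₁ : Deletion G₁} {F₂ : Deletion G₂} {Link : _ → _ → Set} {Link′ : _ → _ → Set} →
                 (∀ x y → Link y x → Link′ x y) → Split F₁ F₂ Link → Split F₂ F₁ Link′
transposeSplit imp s = record
  { cross = λ y x → cross x y ; x-nonneg = λ y x → x-nonneg x y
  ; x-supp = λ y x → Sum.map₂ (λ (alive₁ , alive₂ , linked) → alive₂ , alive₁ , imp y x linked) (x-supp x y)
  ; left = right ; right = left ; x-left = x-right ; x-right = x-left }
  where open Split s

pushed : ∀ {a b} → (Fin a → Fin b) → (Fin a → ℚ) → Fin a → Fin b → ℚ
pushed τ d x y = if ⌊ τ x ≟ y ⌋ then d x else 0ℚ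

fibre≤pair : ∀ {a b} (τ : Fin a → Fin b) (d : Fin a → ℚ) → (∀ x → 0ℚ ℚ.≤ d x) → ∀ {y} i j →
             (∀ x → τ x ≡ y → x ≡ i ⊎ x ≡ j) → sumℚ (λ x → pushed τ d x y) ℚ.≤ d i ℚ.+ d j
fibre≤pair τ d 0≤d {y} i j only = subst (sumℚ (λ x → pushed τ d x y) ℚ.≤_)
  (trans (Σℚ.sum-⊕ (λ x → if ⌊ i ≟ x ⌋ then d i else 0ℚ) _)
    (cong₂ ℚ._+_ (Σℚ.sum-indicator i (d i)) (Σℚ.sum-indicator j (d j))))
  (Σℚ.sum-mono bound)
  where
  rhs : ∀ x → 0ℚ ℚ.≤ (if ⌊ i ≟ x ⌋ then d i else 0ℚ)
  rhs x = 0≤if ⌊ i ≟ x ⌋ (0≤d i)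
  rhs′ : ∀ x → 0ℚ ℚ.≤ (if ⌊ j ≟ x ⌋ then d j else 0ℚ)
  rhs′ x = 0≤if ⌊ j ≟ x ⌋ (0≤d j)
  bound : ∀ x → pushed τ d x y ℚ.≤ (if ⌊ i ≟ x ⌋ then d i else 0ℚ) ℚ.+ (if ⌊ j ≟ x ⌋ then d j else 0ℚ)
  bound x with τ x ≟ y
  ... | no _ = +-nonneg (rhs x) (rhs′ x)
  ... | yes τx≡y with only x τx≡y
  ...   | inj₁ refl rewrite ⌊≟⌋-refl x = p≤p+q (rhs′ x)
  ...   | inj₂ refl rewrite ⌊≟⌋-refl x = subst (d x ℚ.≤_) (ℚ.+-comm (d x) _) (p≤p+q (rhs x))

fibre≤single : ∀ {a b} (τ : Fin a → Fin b) (d : Fin a → ℚ) → (∀ x → 0ℚ ℚ.≤ d x) → ∀ {y} i →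
               (∀ x → τ x ≡ y → x ≡ i) → sumℚ (λ x → pushed τ d x y) ℚ.≤ d i
fibre≤single τ d 0≤d {y} i only = subst (sumℚ (λ x → pushed τ d x y) ℚ.≤_) (Σℚ.sum-indicator i (d i)) (Σℚ.sum-mono bound)
  where
  bound : ∀ x → pushed τ d x y ℚ.≤ (if ⌊ i ≟ x ⌋ then d i else 0ℚ)
  bound x with τ x ≟ y
  ... | no _ = 0≤if ⌊ i ≟ x ⌋ (0≤d i)
  ... | yes τx≡y with only x τx≡y
  ...   | refl rewrite ⌊≟⌋-refl x = ℚ.≤-refl

-- Every vertex sends its whole deficit to its image under `τ`, so the arrivals sum to `total m` and
-- form a matchable demand on `G₂`. The fibre bound takes the place of injectivity, which fails
-- after a rerouting.
push : ∀ {G₁ G₂ k} {F₁ : Deletion G₁} {F₂ : Deletion G₂} {Link} → Robust G₂ k →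
       (m : FracMatching G₁ F₁) (τ : Fin (N G₁) → Fin (N G₂)) →
       (∀ x → delV F₂ (τ x) ≡ false × Link x (τ x)) →
       (∀ y → sumℚ (λ x → pushed τ (deficit m) x y) ℚ.≤ 1ℚ) →
       ∀ r → total m ℚ.≤ fromℕ r → r + size F₂ < k → ¬ ¬ Split F₁ F₂ Link
push {G₁} {G₂} {F₁ = F₁} {F₂} {Link} robust m τ linked fibre≤1 r total≤r r+F₂<k no-split =
  matchable robust F₂ r r+F₂<k e (λ y → Σℚ.sum-nonneg (λ x → 0≤X x y)) fibre≤1
    (subst (ℚ._≤ fromℕ r) (sym Σe≡total) total≤r)
    λ (m₂ , load≡) → no-split (record
      { cross = X ; x-nonneg = 0≤X ; x-supp = supp ; left = m ; right = m₂ ; x-left = row ; x-right = column m₂ load≡ })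
  where
  X = pushed τ (deficit m)
  e : Fin (N G₂) → ℚ
  e y = sumℚ (λ x → X x y)
  0≤X : ∀ x y → 0ℚ ℚ.≤ X x y
  0≤X x y = 0≤if ⌊ τ x ≟ y ⌋ (deficit-nonneg m x)
  row : ∀ x → sumℚ (X x) ≡ deficit m x
  row x = Σℚ.sum-indicator (τ x) (deficit m x)
  Σe≡total : sumℚ e ≡ total m
  Σe≡total = trans (sym (Σℚ.sum-swap X)) (Σℚ.sum-cong row)
  supp : ∀ x y → X x y ≡ 0ℚ ⊎ (delV F₁ x ≡ false × delV F₂ y ≡ false × Link x y)
  supp x y with τ x ≟ y
  ... | no _ = inj₁ refl
  ... | yes refl with delV F₁ x in eq
  ...   | true  = inj₁ (trans (cong (λ b → ⟦ not b ⟧ ℚ.- load m x) (sym eq)) (deficit-dead m x eq))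
  ...   | false = inj₂ (refl , linked x)
  -- A deleted `y` is outside the image of `τ` by `linked`, so nothing arrives there.
  e-dead : ∀ y → delV F₂ y ≡ true → e y ≡ 0ℚ
  e-dead y dead = Σℚ.sum-ε (λ x → zero-at x)
    where
    zero-at : ∀ x → X x y ≡ 0ℚ
    zero-at x with τ x ≟ y
    ... | no _ = refl
    ... | yes refl with trans (sym dead) (proj₁ (linked x))
    ...   | ()
  column : ∀ (m₂ : FracMatching G₂ F₂) → (∀ v → load m₂ v ≡ ⟦ alive F₂ v ⟧ ℚ.* (1ℚ ℚ.- e v)) →
           ∀ y → e y ≡ deficit m₂ y
  column m₂ load≡ y = go (delV F₂ y) refl
    where
    go : ∀ b → delV F₂ y ≡ b → e y ≡ deficit m₂ y
    go true  eq = trans (e-dead y eq) (sym (deficit-dead m₂ y eq))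
    go false eq = sym (begin
      ⟦ alive F₂ y ⟧ ℚ.- load m₂ y      ≡⟨ cong (λ l → ⟦ alive F₂ y ⟧ ℚ.- l) (load≡ y) ⟩
      ⟦ alive F₂ y ⟧ ℚ.- ⟦ alive F₂ y ⟧ ℚ.* (1ℚ ℚ.- e y)  ≡⟨ cong (λ b → ⟦ not b ⟧ ℚ.- ⟦ not b ⟧ ℚ.* (1ℚ ℚ.- e y)) eq ⟩
      1ℚ ℚ.- 1ℚ ℚ.* (1ℚ ℚ.- e y)        ≡⟨ solve 1 (λ e → con 1ℚ :- con 1ℚ :* (con 1ℚ :- e) := e) refl (e y) ⟩
      e y                               ∎)
      where open ≡-Reasoning

to≡⇒≡from : ∀ {a b} (M : Fin a ↔ Fin b) {x y} → to M x ≡ y → x ≡ from M y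
to≡⇒≡from M {x} refl = sym (strictlyInverseʳ M x)

Link : ∀ {a b} → Fin a ↔ Fin b → Fin a ↔ Fin b → (Fin a → Fin b → Bool) → Fin a → Fin b → Set
Link M₁ M₂ C x y = (to M₁ x ≡ y ⊎ to M₂ x ≡ y) × C x y ≡ false

module _ {G₁ G₂ : Graph} {k : ℕ} (5≤k : 5 ≤ k) (robust₁ : Robust G₁ k) (robust₂ : Robust G₂ k)
  (M₁ M₂ : Fin (N G₁) ↔ Fin (N G₂)) (disjoint : ∀ x → to M₁ x ≢ to M₂ x)
  (F₁ : Deletion G₁) (F₂ : Deletion G₂) (C : Fin (N G₁) → Fin (N G₂) → Bool) where

  private
    outside : ℕ
    outside = size F₂ + sumℕ (λ x → count (C x))

    -- A deleted `x` does not count as an obstacle: its deficit is 0, so it sends nothing.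
    blocked : Fin (N G₁) → Fin (N G₂) → Bool
    blocked x y = delV F₂ y ∨ C x y

    unblocked : ∀ {x y} → blocked x y ≡ false → delV F₂ y ≡ false × C x y ≡ false
    unblocked {x} {y} eq with delV F₂ y
    ... | false = refl , eq

    obstruction : Fin (N G₂) → ℕ
    obstruction y = (if delV F₂ y then 1 else 0) + count (λ x → C x y)

    Σ-obstruction : sumℕ obstruction ≤ outside
    Σ-obstruction = ℕ.≤-trans
      (ℕ.≤-reflexive (trans (Σℕ.sum-⊕ (λ y → if delV F₂ y then 1 else 0) (λ y → count (λ x → C x y)))
        (cong (count (delV F₂) +_) (sym (Σℕ.sum-swap (λ x y → if C x y then 1 else 0))))))
      (ℕ.+-monoˡ-≤ _ (ℕ.m≤m+n (count (delV F₂)) _))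

    blocked⇒obstruction : ∀ x y → blocked x y ≡ true → 1 ≤ obstruction y
    blocked⇒obstruction x y eq with delV F₂ y
    ... | true  = s≤s z≤n
    ... | false = subst (λ b → (if b then 1 else 0) ≤ count (λ x′ → C x′ y)) eq
                    (Σℕ.term≤sum {f = λ x′ → if C x′ y then 1 else 0} (λ _ → z≤n) x)

    -- Each deleted vertex of `G₂` and each cross fault is charged to one vertex of `G₂`, so blocked
    -- pairs at two different vertices would need two outside faults.
    blocked-unique : outside ≤ 1 → ∀ {x y} → blocked x y ≡ true → ∀ x′ y′ → y ≢ y′ → blocked x′ y′ ≡ false
    blocked-unique out≤1 {x} {y} b x′ y′ y≢y′ with blocked x′ y′ in b′
    ... | false = refl
    ... | true  = ⊥-elim (ℕ.<-irrefl refl (ℕ.≤-trans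
      (ℕ.+-mono-≤ (blocked⇒obstruction x y b) (blocked⇒obstruction x′ y′ b′))
      (ℕ.≤-trans (Σℕ.two-terms≤sum (λ _ → z≤n) y y′ y≢y′) (ℕ.≤-trans Σ-obstruction out≤1))))

  splitBalanced : size F₁ < k → size F₂ < k → ¬ ¬ Split F₁ F₂ (Link M₁ M₂ C)
  splitBalanced F₁<k F₂<k no-split = perfect robust₁ F₁ F₁<k λ (m₁ , full₁) →
    perfect robust₂ F₂ F₂<k λ (m₂ , full₂) → no-split (record
      { cross = λ _ _ → 0ℚ ; x-nonneg = λ _ _ → ℚ.≤-refl ; x-supp = λ _ _ → inj₁ refl ; left = m₁ ; right = m₂
      ; x-left = λ x → trans (Σℚ.sum-const-ε {N G₂}) (sym (full₁ x))
      ; x-right = λ y → trans (Σℚ.sum-const-ε {N G₁}) (sym (full₂ y)) })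

  -- The hypotheses force `outside ≤ 1`. If no edge of `M₁` is blocked, all deficits travel along
  -- `M₁`. Otherwise the single outside fault blocks `M₁` at some `x₀`; the left half then has
  -- exactly `k` faults, so one restoration suffices.
  splitHeavyLeft : k ≤ size F₁ → size F₁ + outside ≤ suc k → ¬ ¬ Split F₁ F₂ (Link M₁ M₂ C)
  splitHeavyLeft k≤F₁ total≤ with Fin.any? (λ x → blocked x (to M₁ x) Bool.≟ true)
  ... | no free = viaM₁ outside refl
    where
    free-M₁ : ∀ x → delV F₂ (to M₁ x) ≡ false × Link M₁ M₂ C x (to M₁ x)
    free-M₁ x with unblocked {x} {to M₁ x} (Bool.¬-not (λ b → free (x , b)))
    ... | alive , kept = alive , inj₁ refl , kept
    viaM₁At : ∀ j → size F₁ < k + j → j * 2 + size F₂ < k → ¬ ¬ Split F₁ F₂ (Link M₁ M₂ C)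
    viaM₁At j F₁<k+j fits no-split = nearlyPerfect robust₁ (ℕ.≤-trans (s≤s z≤n) 5≤k) j F₁ F₁<k+j λ (m , m≤) →
      push robust₂ m (to M₁) free-M₁
        (λ y → ℚ.≤-trans (fibre≤single (to M₁) (deficit m) (deficit-nonneg m) (from M₁ y) (λ _ → to≡⇒≡from M₁))
                 (deficit≤1 m (from M₁ y)))
        (j * 2) m≤ fits no-split
    viaM₁ : ∀ o → outside ≡ o → ¬ ¬ Split F₁ F₂ (Link M₁ M₂ C)
    -- The left half may have `k + 1` faults: two are restored, the deficit is at most 4, and
    -- `4 < k` is precisely `5≤k`.
    viaM₁ zero out≡ = viaM₁At 2
      (subst (suc (size F₁) ≤_) (ℕ.+-comm 2 k) (s≤s (ℕ.≤-trans (ℕ.m≤m+n (size F₁) outside) total≤)))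
      (ℕ.≤-trans (s≤s (ℕ.+-monoʳ-≤ 4 (ℕ.≤-trans (ℕ.m≤m+n (size F₂) _) (ℕ.≤-reflexive out≡)))) 5≤k)
    -- An outside fault leaves at most `k` in the left half, so one restoration and deficit 2
    -- suffice.
    viaM₁ (suc o) out≡ = viaM₁At 1
      (subst (suc (size F₁) ≤_) (ℕ.+-comm 1 k) (ℕ.≤-trans (ℕ.≤-trans (ℕ.≤-reflexive (ℕ.+-comm 1 _))
        (ℕ.+-monoʳ-≤ (size F₁) (subst (1 ≤_) (sym out≡) (s≤s z≤n)))) total≤))
      (ℕ.≤-trans (s≤s (ℕ.+-monoʳ-≤ 2 F₂≤1)) (ℕ.≤-trans (s≤s (s≤s (s≤s (s≤s z≤n)))) 5≤k))
      where
      F₂≤1 : size F₂ ≤ 1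
      F₂≤1 = ℕ.≤-trans (ℕ.m≤m+n (size F₂) _)
        (ℕ.+-cancelˡ-≤ k _ _ (ℕ.≤-trans (ℕ.+-monoˡ-≤ outside k≤F₁) (subst (size F₁ + outside ≤_) (ℕ.+-comm 1 k) total≤)))
  ... | yes (x₀ , x₀-blocked) = λ no-split →
    nearlyPerfectAt robust₁ (ℕ.≤-trans (s≤s (s≤s z≤n)) 5≤k) F₁ F₁≡k x₀ x₁ x₀≢x₁ λ (m , m≤ , pair≤1) →
      push robust₂ m τ free-τ (fibre m pair≤1) 2 m≤
        (ℕ.≤-trans (s≤s (ℕ.+-monoʳ-≤ 2 (ℕ.≤-trans (ℕ.m≤m+n (size F₂) _) out≤1))) (ℕ.≤-trans (s≤s (s≤s (s≤s (s≤s z≤n)))) 5≤k))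
        no-split
    where
    -- `x₀` is rerouted to `z` along `M₂`, and the `M₁`-partner `x₁` of `z` sends its deficit there
    -- too; hence the joint bound requested at `x₀` and `x₁`.
    z = to M₂ x₀
    x₁ = from M₁ z
    x₀≢x₁ : x₀ ≢ x₁
    x₀≢x₁ eq = disjoint x₀ (trans (cong (to M₁) eq) (strictlyInverseˡ M₁ z))
    out≤1 : outside ≤ 1
    out≤1 = ℕ.+-cancelˡ-≤ k _ _ (ℕ.≤-trans (ℕ.+-monoˡ-≤ outside k≤F₁) (subst (size F₁ + outside ≤_) (ℕ.+-comm 1 k) total≤))
    1≤out : 1 ≤ outside
    1≤out = ℕ.≤-trans (blocked⇒obstruction x₀ _ x₀-blocked)
      (ℕ.≤-trans (Σℕ.term≤sum {f = obstruction} (λ _ → z≤n) (to M₁ x₀)) Σ-obstruction)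
    F₁≡k : size F₁ ≡ k
    F₁≡k = ℕ.≤-antisym (ℕ.+-cancelʳ-≤ 1 _ _ (ℕ.≤-trans (ℕ.+-monoʳ-≤ (size F₁) 1≤out)
      (subst (size F₁ + outside ≤_) (ℕ.+-comm 1 k) total≤))) k≤F₁
    -- No vertex is now sent to the obstructed `to M₁ x₀`: injectivity of `M₁` excludes the others,
    -- and disjointness of the matchings excludes `x₀`.
    τ : Fin (N G₁) → Fin (N G₂)
    τ x = if ⌊ x ≟ x₀ ⌋ then z else to M₁ x
    free-τ : ∀ x → delV F₂ (τ x) ≡ false × Link M₁ M₂ C x (τ x)
    free-τ x with x ≟ x₀
    ... | yes refl with unblocked {x₀} {z} (blocked-unique out≤1 x₀-blocked x₀ z (disjoint x₀))
    ...   | alive , kept = alive , inj₂ refl , kept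
    free-τ x | no x≢x₀ with unblocked {x} {to M₁ x} (blocked-unique out≤1 x₀-blocked x (to M₁ x)
                              (λ eq → x≢x₀ (sym (trans (to≡⇒≡from M₁ eq) (strictlyInverseʳ M₁ x)))))
    ...   | alive , kept = alive , inj₁ refl , kept
    τ-fibre : ∀ {y} x → τ x ≡ y → x ≡ from M₁ y ⊎ (x ≡ x₀ × y ≡ z)
    τ-fibre x eq with x ≟ x₀
    ... | yes x≡x₀ = inj₂ (x≡x₀ , sym eq)
    ... | no _     = inj₁ (to≡⇒≡from M₁ eq)
    fibre : (m : FracMatching G₁ F₁) → deficit m x₀ ℚ.+ deficit m x₁ ℚ.≤ 1ℚ →
            ∀ y → sumℚ (λ x → pushed τ (deficit m) x y) ℚ.≤ 1ℚ
    fibre m pair≤1 y with y ≟ z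
    ... | yes refl = ℚ.≤-trans (fibre≤pair τ (deficit m) (deficit-nonneg m) x₀ x₁ cases) pair≤1
      where
      cases : ∀ x → τ x ≡ z → x ≡ x₀ ⊎ x ≡ x₁
      cases x eq with τ-fibre x eq
      ... | inj₁ x≡x₁       = inj₂ x≡x₁
      ... | inj₂ (x≡x₀ , _) = inj₁ x≡x₀
    ... | no y≢z = ℚ.≤-trans (fibre≤single τ (deficit m) (deficit-nonneg m) (from M₁ y) cases) (deficit≤1 m (from M₁ y))
      where
      cases : ∀ x → τ x ≡ y → x ≡ from M₁ y
      cases x eq with τ-fibre x eq
      ... | inj₁ x≡       = x≡
      ... | inj₂ (_ , y≡z) = ⊥-elim (y≢z y≡z)

-- A heavy second half is the mirror image of a heavy first one, with inverse matchings and
-- transposed cross faults.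
splitExists : ∀ {G₁ G₂ k} → 5 ≤ k → Robust G₁ k → Robust G₂ k →
  (M₁ M₂ : Fin (N G₁) ↔ Fin (N G₂)) → (∀ x → to M₁ x ≢ to M₂ x) →
  (F₁ : Deletion G₁) (F₂ : Deletion G₂) (C : Fin (N G₁) → Fin (N G₂) → Bool) →
  size F₁ + size F₂ + sumℕ (λ x → count (C x)) ≤ suc k → ¬ ¬ Split F₁ F₂ (Link M₁ M₂ C)
splitExists {G₁} {G₂} {k} 5≤k robust₁ robust₂ M₁ M₂ disjoint F₁ F₂ C total≤ no-split with size F₁ ℕ.<? k | size F₂ ℕ.<? k
... | yes F₁<k | yes F₂<k = splitBalanced 5≤k robust₁ robust₂ M₁ M₂ disjoint F₁ F₂ C F₁<k F₂<k no-split
... | no F₁≮k | _ = splitHeavyLeft 5≤k robust₁ robust₂ M₁ M₂ disjoint F₁ F₂ C (ℕ.≮⇒≥ F₁≮k)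
  (subst (_≤ suc k) (ℕ.+-assoc (size F₁) _ _) total≤) no-split
... | yes _ | no F₂≮k = splitHeavyLeft 5≤k robust₂ robust₁ (↔-sym M₁) (↔-sym M₂) disjoint′
  F₂ F₁ (λ y x → C x y) (ℕ.≮⇒≥ F₂≮k)
  total≤′ (no-split ∘ transposeSplit flip-link)
  where
  disjoint′ : ∀ y → from M₁ y ≢ from M₂ y
  disjoint′ y eq = disjoint (from M₁ y)
    (trans (strictlyInverseˡ M₁ y) (sym (trans (cong (to M₂) eq) (strictlyInverseˡ M₂ y))))
  total≤′ : size F₂ + (size F₁ + sumℕ (λ y → count (λ x → C x y))) ≤ suc k
  total≤′ = subst (_≤ suc k) (begin
    size F₁ + size F₂ + sumℕ (λ x → count (C x))                ≡⟨ cong₂ _+_ (ℕ.+-comm (size F₁) (size F₂))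
                                                                     (Σℕ.sum-swap (λ x y → if C x y then 1 else 0)) ⟩
    size F₂ + size F₁ + sumℕ (λ y → count (λ x → C x y))        ≡⟨ ℕ.+-assoc (size F₂) (size F₁) _ ⟩
    size F₂ + (size F₁ + sumℕ (λ y → count (λ x → C x y)))      ∎) total≤
    where open ≡-Reasoning
  flip-link : ∀ x y → Link (↔-sym M₁) (↔-sym M₂) (λ y x → C x y) y x → Link M₁ M₂ C x y
  flip-link x y (inj₁ refl , kept) = inj₁ (strictlyInverseˡ M₁ y) , kept
  flip-link x y (inj₂ refl , kept) = inj₂ (strictlyInverseˡ M₂ y) , kept

-- Combined graphs

Regular : Graph → ℕ → Set
Regular G d = ∀ v → count (adj G v) ≡ d

count-pair : ∀ {n} {i j : Fin n} → i ≢ j → count (λ l → ⌊ i ≟ l ⌋ ∨ ⌊ j ≟ l ⌋) ≡ 2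
count-pair {i = i} {j} i≢j = trans (Σℕ.sum-cong either)
  (trans (Σℕ.sum-⊕ (λ l → if ⌊ i ≟ l ⌋ then 1 else 0) _) (cong₂ _+_ (Σℕ.sum-indicator i 1) (Σℕ.sum-indicator j 1)))
  where
  either : ∀ l → (if ⌊ i ≟ l ⌋ ∨ ⌊ j ≟ l ⌋ then 1 else 0) ≡ (if ⌊ i ≟ l ⌋ then 1 else 0) + (if ⌊ j ≟ l ⌋ then 1 else 0)
  either l with i ≟ l | j ≟ l
  ... | yes i≡l | yes j≡l = ⊥-elim (i≢j (trans i≡l (sym j≡l)))
  ... | yes _   | no _    = refl
  ... | no _    | yes _   = refl
  ... | no _    | no _    = refl

⌊to≟⌋ : ∀ {a b} (M : Fin a ↔ Fin b) x y → ⌊ to M x ≟ y ⌋ ≡ ⌊ from M y ≟ x ⌋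
⌊to≟⌋ M x y with to M x ≟ y | from M y ≟ x
... | yes _   | yes _   = refl
... | no _    | no _    = refl
... | yes eq  | no neq  = ⊥-elim (neq (sym (to≡⇒≡from M eq)))
... | no neq  | yes refl = ⊥-elim (neq (strictlyInverseˡ M y))

module _ {G₁ G₂ : Graph} (M₁ M₂ : Fin (N G₁) ↔ Fin (N G₂)) (disjoint : ∀ x → to M₁ x ≢ to M₂ x) where

  private
    a = N G₁
    b = N G₂
    G : Graph
    G = combine G₁ G₂ (to M₁) (to M₂)

  combine-regular : ∀ {d} → Regular G₁ d → Regular G₂ d → Regular G (d + 2)
  combine-regular {d} reg₁ reg₂ u = trans (Σℕ.sum-splitAt a _)
    (trans (cong₂ _+_ (Σℕ.sum-cong toLeft) (Σℕ.sum-cong toRight)) (degree (splitAt a u)))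
    where
    adjTo : Fin a ⊎ Fin b → ℕ
    adjTo t = if sumAdj (adj G₁) (adj G₂) (to M₁) (to M₂) (splitAt a u) t then 1 else 0
    toLeft : ∀ x → adjTo (splitAt a (x ↑ˡ b)) ≡ adjTo (inj₁ x)
    toLeft x = cong adjTo (Fin.splitAt-↑ˡ a x b)
    toRight : ∀ y → adjTo (splitAt a (a ↑ʳ y)) ≡ adjTo (inj₂ y)
    toRight y = cong adjTo (Fin.splitAt-↑ʳ a b y)
    degree : ∀ s → count (λ x → sumAdj (adj G₁) (adj G₂) (to M₁) (to M₂) s (inj₁ x)) +
                   count (λ y → sumAdj (adj G₁) (adj G₂) (to M₁) (to M₂) s (inj₂ y)) ≡ d + 2
    degree (inj₁ x) = cong₂ _+_ (reg₁ x) (count-pair (disjoint x))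
    -- Seen from the right half, the two cross neighbours of `y` are its preimages, which differ
    -- because the matchings are disjoint.
    degree (inj₂ y) = trans (cong₂ _+_
      (trans (Σℕ.sum-cong (λ x → cong (if_then 1 else 0) (cong₂ _∨_ (⌊to≟⌋ M₁ x y) (⌊to≟⌋ M₂ x y)))) (count-pair from≢))
      (reg₂ y)) (ℕ.+-comm 2 d)
      where
      from≢ : from M₁ y ≢ from M₂ y
      from≢ eq = disjoint (from M₁ y)
        (trans (strictlyInverseˡ M₁ y) (sym (trans (cong (to M₂) eq) (strictlyInverseˡ M₂ y))))

  module _ (F : Deletion G) where

    leftDel : Deletion G₁
    leftDel = record
      { delV = λ x → delV F (x ↑ˡ b) ; delE = λ x x′ → delE F (x ↑ˡ b) (x′ ↑ˡ b)
      ; delE-sym = λ x x′ → delE-sym F _ _ ; delE-adj = adjacent }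
      where
      adjacent : ∀ x x′ → delE F (x ↑ˡ b) (x′ ↑ˡ b) ≡ true → adj G₁ x x′ ≡ true
      adjacent x x′ e with delE-adj F _ _ e
      ... | adj≡ rewrite Fin.splitAt-↑ˡ a x b | Fin.splitAt-↑ˡ a x′ b = adj≡

    rightDel : Deletion G₂
    rightDel = record
      { delV = λ y → delV F (a ↑ʳ y) ; delE = λ y y′ → delE F (a ↑ʳ y) (a ↑ʳ y′)
      ; delE-sym = λ y y′ → delE-sym F _ _ ; delE-adj = adjacent }
      where
      adjacent : ∀ y y′ → delE F (a ↑ʳ y) (a ↑ʳ y′) ≡ true → adj G₂ y y′ ≡ true
      adjacent y y′ e with delE-adj F _ _ e
      ... | adj≡ rewrite Fin.splitAt-↑ʳ a b y | Fin.splitAt-↑ʳ a b y′ = adj≡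

    crossDel : Fin a → Fin b → Bool
    crossDel x y = delE F (x ↑ˡ b) (a ↑ʳ y)

    -- Left indices precede right ones, so a deleted cross edge is counted once, in the row of its
    -- left end.
    size-combine : size F ≡ size leftDel + size rightDel + sumℕ (λ x → count (crossDel x))
    size-combine = trans (cong₂ _+_ (Σℕ.sum-splitAt a _) (trans (Σℕ.sum-splitAt a _)
        (cong₂ _+_ (trans (Σℕ.sum-cong leftRow) (Σℕ.sum-⊕ (count ∘ upper leftDel) (count ∘ crossDel))) (Σℕ.sum-cong rightRow))))
      (rearrange (count (delV leftDel)) (count (delV rightDel)) _ _ _)
      where
      rearrange : ∀ p q r s t → p + q + ((r + s) + t) ≡ (p + r) + (q + t) + s
      rearrange = solve-∀
      left<right : ∀ x y → toℕ (x ↑ˡ b) < toℕ (a ↑ʳ y)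
      left<right x y = subst₂ _<_ (sym (Fin.toℕ-↑ˡ x b)) (sym (Fin.toℕ-↑ʳ a y))
        (ℕ.<-≤-trans (Fin.toℕ<n x) (ℕ.m≤m+n a (toℕ y)))
      leftRow : ∀ x → count (upper F (x ↑ˡ b)) ≡ count (upper leftDel x) + count (crossDel x)
      leftRow x = trans (Σℕ.sum-splitAt a _) (cong₂ _+_
        (Σℕ.sum-cong (λ x′ → cong (λ c → if c ∧ delE F (x ↑ˡ b) (x′ ↑ˡ b) then 1 else 0)
          (cong₂ _<ᵇ_ (Fin.toℕ-↑ˡ x b) (Fin.toℕ-↑ˡ x′ b))))
        (Σℕ.sum-cong (λ y → cong (λ c → if c ∧ crossDel x y then 1 else 0) (<ᵇ-true (left<right x y)))))
      rightRow : ∀ y → count (upper F (a ↑ʳ y)) ≡ count (upper rightDel y)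
      rightRow y = trans (Σℕ.sum-splitAt a _) (cong₂ _+_
        (Σℕ.sum-ε (λ x → cong (λ c → if c ∧ delE F (a ↑ʳ y) (x ↑ˡ b) then 1 else 0) (<ᵇ-false (left<right x y))))
        (Σℕ.sum-cong (λ y′ → cong (λ c → if c ∧ delE F (a ↑ʳ y) (a ↑ʳ y′) then 1 else 0)
          (trans (cong₂ _<ᵇ_ (Fin.toℕ-↑ʳ a y) (Fin.toℕ-↑ʳ a y′)) (<ᵇ-shift a)))))
        where
        <ᵇ-shift : ∀ c {i j} → (c + i <ᵇ c + j) ≡ (i <ᵇ j)
        <ᵇ-shift zero    = refl
        <ᵇ-shift (suc c) = <ᵇ-shift c

    -- The inner load of a vertex and its cross weight, which equals its deficit, add up to the
    -- survival indicator.
    glue : Split leftDel rightDel (Link M₁ M₂ crossDel) → FracPerfectMatching G F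
    glue s = toPerfect m (λ v al → trans (load≡ v) (cong (λ c → ⟦ not c ⟧) al))
      where
      open Split s
      W : Fin a ⊎ Fin b → Fin a ⊎ Fin b → ℚ
      W (inj₁ x) (inj₁ x′) = weight left x x′
      W (inj₁ x) (inj₂ y)  = cross x y
      W (inj₂ y) (inj₁ x)  = cross x y
      W (inj₂ y) (inj₂ y′) = weight right y y′

      W-sym : ∀ s t → W s t ≡ W t s
      W-sym (inj₁ x) (inj₁ x′) = w-sym left x x′
      W-sym (inj₁ x) (inj₂ y)  = refl
      W-sym (inj₂ y) (inj₁ x)  = refl
      W-sym (inj₂ y) (inj₂ y′) = w-sym right y y′

      W-nonneg : ∀ s t → 0ℚ ℚ.≤ W s t
      W-nonneg (inj₁ x) (inj₁ x′) = w-nonneg left x x′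
      W-nonneg (inj₁ x) (inj₂ y)  = x-nonneg x y
      W-nonneg (inj₂ y) (inj₁ x)  = x-nonneg x y
      W-nonneg (inj₂ y) (inj₂ y′) = w-nonneg right y y′

      -- A pair with surviving ends and an undeleted link is an edge of the remaining graph, so off
      -- those edges only the zero alternative is left.
      cross-supp : ∀ x y → edgeIn F (x ↑ˡ b) (a ↑ʳ y) ≡ false → cross x y ≡ 0ℚ
      cross-supp x y e with x-supp x y
      ... | inj₁ zer = zer
      ... | inj₂ (alive₁ , alive₂ , via , kept)
        rewrite Fin.splitAt-↑ˡ a x b | Fin.splitAt-↑ʳ a b y | alive₁ | alive₂ | kept with via
      ...   | inj₁ refl rewrite ⌊≟⌋-refl (to M₁ x) with e
      ...     | ()
      cross-supp x y e | inj₂ (alive₁ , alive₂ , via , kept) | inj₂ refl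
        rewrite ⌊≟⌋-refl (to M₂ x) | Bool.∨-zeroʳ ⌊ to M₁ x ≟ to M₂ x ⌋ with e
      ...     | ()

      W-supp : ∀ s t → edgeIn F (join a b s) (join a b t) ≡ false → W s t ≡ 0ℚ
      W-supp (inj₁ x) (inj₁ x′) e = w-supp left x x′ (trans (sym edgeIn≡) e)
        where
        edgeIn≡ : edgeIn F (x ↑ˡ b) (x′ ↑ˡ b) ≡ edgeIn leftDel x x′
        edgeIn≡ rewrite Fin.splitAt-↑ˡ a x b | Fin.splitAt-↑ˡ a x′ b = refl
      W-supp (inj₁ x) (inj₂ y)  e = cross-supp x y e
      W-supp (inj₂ y) (inj₁ x)  e = cross-supp x y (trans (edgeIn-sym F (x ↑ˡ b) (a ↑ʳ y)) e)
      W-supp (inj₂ y) (inj₂ y′) e = w-supp right y y′ (trans (sym edgeIn≡) e)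
        where
        edgeIn≡ : edgeIn F (a ↑ʳ y) (a ↑ʳ y′) ≡ edgeIn rightDel y y′
        edgeIn≡ rewrite Fin.splitAt-↑ʳ a b y | Fin.splitAt-↑ʳ a b y′ = refl

      l+[p-l]≡p : ∀ l p → l ℚ.+ (p ℚ.- l) ≡ p
      l+[p-l]≡p = solve 2 (λ l p → l :+ (p :- l) := p) refl

      rowSum : ∀ s → sumℚ (λ x → W s (inj₁ x)) ℚ.+ sumℚ (λ y → W s (inj₂ y)) ≡ ⟦ alive F (join a b s) ⟧
      rowSum (inj₁ x) = trans (cong (load left x ℚ.+_) (x-left x)) (l+[p-l]≡p (load left x) _)
      rowSum (inj₂ y) = trans (ℚ.+-comm _ (load right y))
        (trans (cong (load right y ℚ.+_) (x-right y)) (l+[p-l]≡p (load right y) _))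

      load≡ : ∀ u → sumℚ (λ v → W (splitAt a u) (splitAt a v)) ≡ ⟦ alive F u ⟧
      load≡ u = begin
        sumℚ (λ v → W (splitAt a u) (splitAt a v))   ≡⟨ Σℚ.sum-splitAt a _ ⟩
        _                                            ≡⟨ cong₂ ℚ._+_
                                                          (Σℚ.sum-cong (λ x → cong (W (splitAt a u)) (Fin.splitAt-↑ˡ a x b)))
                                                          (Σℚ.sum-cong (λ y → cong (W (splitAt a u)) (Fin.splitAt-↑ʳ a b y))) ⟩
        _                                            ≡⟨ rowSum (splitAt a u) ⟩
        ⟦ alive F (join a b (splitAt a u)) ⟧         ≡⟨ cong (λ v → ⟦ alive F v ⟧) (Fin.join-splitAt a b u) ⟩
        ⟦ alive F u ⟧                                ∎
        where open ≡-Reasoning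

      m : FracMatching G F
      m = record
        { weight = λ u v → W (splitAt a u) (splitAt a v)
        ; w-sym = λ u v → W-sym (splitAt a u) (splitAt a v)
        ; w-supp = λ u v e → W-supp (splitAt a u) (splitAt a v)
            (trans (cong₂ (edgeIn F) (Fin.join-splitAt a b u) (Fin.join-splitAt a b v)) e)
        ; w-nonneg = λ u v → W-nonneg (splitAt a u) (splitAt a v)
        ; load≤1 = λ u → subst (ℚ._≤ 1ℚ) (sym (load≡ u)) (⟦ alive F u ⟧≤1) }

  combine-robust : ∀ {k} → 5 ≤ k → Robust G₁ k → Robust G₂ k → Robust G (2 + k)
  combine-robust {k} 5≤k robust₁ robust₂ F F<2+k no-pm =
    splitExists 5≤k robust₁ robust₂ M₁ M₂ disjoint (leftDel F) (rightDel F) (crossDel F)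
      (subst (_≤ suc k) (size-combine F) (ℕ.≤-pred F<2+k)) (no-pm ∘ glue F)

-- The preclusion number of regular graphs and of the family

fsmp⇒robust : ∀ {G k} → FsmpEq G k → Robust G k
fsmp⇒robust (_ , minimal) F F<k no-pm = ℕ.<⇒≱ F<k (minimal F no-pm)

-- Deleting the `k` neighbours of `v` isolates it, while `v` survives because there are no loops;
-- the weights at `v` then sum to 0 instead of 1.
robust+regular⇒fsmp : ∀ {G k} → Robust G k → Regular G k → Fin (N G) → FsmpEq G k
robust+regular⇒fsmp {G} {k} robust regular v =
  (nbhd , isolated , size≡) , λ F no-pm → ℕ.≮⇒≥ (λ F<k → robust F F<k no-pm)
  where
  nbhd : Deletion G
  nbhd = record { delV = adj G v ; delE = λ _ _ → false ; delE-sym = λ _ _ → refl ; delE-adj = λ _ _ () }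
  size≡ : size nbhd ≡ k
  size≡ = trans (cong₂ _+_ (regular v)
      (Σℕ.sum-ε {N G} (λ u → Σℕ.sum-ε {N G} (λ w → cong (if_then 1 else 0) (Bool.∧-zeroʳ (toℕ u <ᵇ toℕ w))))))
    (ℕ.+-identityʳ k)
  noEdge : ∀ u → edgeIn nbhd v u ≡ false
  noEdge u with adj G v u
  ... | true  = Bool.∧-zeroʳ _
  ... | false = Bool.∧-zeroʳ _
  isolated : IsFSMPSet G nbhd
  isolated pm with trans (sym (f-sum v (cong not (adj-irr G v)))) (Σℚ.sum-ε (λ u → f-supp v u (noEdge u)))
    where open FracPerfectMatching pm
  ... | ()

GAQ-vertex : ∀ {n G} → GAQ n G → Fin (N G)
GAQ-vertex base             = zero
GAQ-vertex (step g _ _ _ _) = GAQ-vertex g ↑ˡ _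

GAQ-positive : ∀ {n G} → GAQ n G → 1 ≤ n
GAQ-positive base             = s≤s z≤n
GAQ-positive (step _ _ _ _ _) = s≤s z≤n

GAQ-regular : ∀ {n G} → GAQ n G → Regular G (2 * n ∸ 1)
-- The 16 degrees of `AQ 4` are checked by evaluation; 7 is `2 * 4 ∸ 1`.
GAQ-regular base = toWitness {a? = Fin.all? (λ v → count (adj (AQ 4) v) ℕ.≟ 7)} _
GAQ-regular (step {n} {G₁} {G₂} g₁ g₂ M₁ M₂ disjoint) v =
  trans (combine-regular {G₁} {G₂} M₁ M₂ disjoint (GAQ-regular g₁) (GAQ-regular g₂) v) (degree n (GAQ-positive g₁))
  where
  -- The bound `1 ≤ n` keeps the subtraction from being truncated.
  degree : ∀ n → 1 ≤ n → 2 * n ∸ 1 + 2 ≡ 2 * suc n ∸ 1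
  degree (suc n) _ = trans (ℕ.+-comm (n + suc (n + 0)) 2) (cong suc (sym (ℕ.+-suc n (suc (n + 0)))))

theorem3p2 : ∀ (n : ℕ) → 5 ≤ n
    → (∀ (G : Graph) → GAQ (n ∸ 1) G → FsmpEq G (2 * n ∸ 3))
    → ∀ (G : Graph) → GAQ n G → FsmpEq G (2 * n ∸ 1)
-- With `n` in the form `5 + j` the case `base` cannot occur, and `2 + (2 * n ∸ 3)` and `2 * n ∸ 1`
-- agree by computation.
theorem3p2 _ (s≤s (s≤s (s≤s (s≤s (s≤s {n = j} z≤n))))) fsmp _ gaq@(step {G₁ = G₁} {G₂} g₁ g₂ M₁ M₂ disjoint) =
  robust+regular⇒fsmp
    (combine-robust M₁ M₂ disjoint 5≤k (fsmp⇒robust (fsmp G₁ g₁)) (fsmp⇒robust (fsmp G₂ g₂)))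
    (GAQ-regular gaq) (GAQ-vertex gaq)
  where
  5≤k : 5 ≤ 2 * (5 + j) ∸ 3
  5≤k = s≤s (s≤s (ℕ.≤-trans (s≤s (s≤s (s≤s z≤n))) (ℕ.m≤n+m _ j)))
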